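{- Let $D\ge 3$. There are countably infinitely many (up to isomorphism) infinite graphs that are strongly isolated in $(\mathfrak{G}_{\le D},d)$, and hence also in $(\mathfrak{G}^{\infty}_{\le D},d)$.
   Context: Graphs are simple. $\mathfrak{G}_{\le D}$ is the set of connected graphs of maximum degree at most $D$, up to isomorphism; $\mathfrak{G}^{\infty}_{\le D}$ is the subset of infinite ones. For a graph $G$ and $r\ge 0$, $B_r(G,v)$ is the subgraph induced by the vertices at distance at most $r$ from $v$, rooted at $v$, and $\mathfrak{B}_r(G)=\{B_r(G,v): v\in V(G)\}$, a set of rooted graphs up to root-preserving isomorphism (multiplicities ignored). The pseudometric $d$ on $\mathfrak{G}_{\le D}$ is $d(G_1,G_2)=\inf\{2^{ -r}: \mathfrak{B}_r(G_1)=\mathfrak{B}_r(G_2)\}$, where equality is as sets of root-preserving isomorphism classes. A point $x$ of a pseudometric space $(X,d)$ is strongly isolated if there is $\varepsilon>0$ such that no $x'\in X$ with $x'\neq x$ satisfies $d(x,x')\le\varepsilon$; for graphs, $x'\ne x$ means non-isomorphic. -}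

module Defs where

open import Axiom.ExcludedMiddle using (ExcludedMiddle)
open import Data.Empty using (⊥-elim)
open import Data.Fin.Base using (Fin)
import Data.Integer.Base as ℤ
import Data.Integer.Properties as ℤ
open import Data.Irrelevant using ([_])
open import Data.Nat.Base as ℕ using (ℕ; zero; suc; z≤n; s≤s)
import Data.Nat.Properties as ℕ
open import Data.Product.Base using (Σ; ∃; ∃-syntax; _×_; _,_; proj₁; proj₂)
open import Data.Rational.Base as ℚ using (ℚ; 0ℚ; mkℚ; _/_)
import Data.Rational.Properties as ℚ
import Data.Rational.Unnormalised.Base as ℚᵘ
import Data.Rational.Unnormalised.Properties as ℚᵘ
open import Data.Refinement using (Refinement-syntax; value; _,_)
open import Function.Base using (_on_)
open import Function.Bundles
  using (Bijection; Inverse; _↔_; _↣_; _⇔_; mk⇔; mk↔ₛ′)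
import Function.Construct.Composition as Compose
import Function.Construct.Identity as Identity
import Function.Construct.Symmetry as Symmetry
open import Function.Metric.Rational.Core using (DistanceFunction)
open import Level using (Level; 0ℓ; _⊔_) renaming (suc to lsuc)
open import Relation.Binary.Bundles using (Setoid)
open import Relation.Binary.Core using (Rel)
open import Relation.Binary.Definitions using (Irreflexive; Symmetric)
import Relation.Binary.Construct.On as On
open import Relation.Binary.PropositionalEquality
  using (_≡_; refl; sym; trans; cong; subst; subst₂)
import Relation.Binary.PropositionalEquality as ≡
open import Relation.Nullary using (¬_; yes; no; recompute)
open import Relation.Unary using (Pred; _∈_; _≐_)

private
  variable
    a p ℓ : Level

record Graph : Set₁ where
  infix 4 _~_
  field
    V        : Set
    _~_      : Rel V 0ℓ
    ~-sym    : Symmetric _~_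
    ~-irrefl : Irreflexive _≡_ _~_

open Graph using (V)

-- Adjacency may have several proofs, but only its inhabitation matters:
-- isomorphisms preserve and reflect it up to logical equivalence.

infix 4 _≅_

record _≅_ (G H : Graph) : Set where
  private
    module G = Graph G
    module H = Graph H
  field
    bijection : G.V ↔ H.V
  open Inverse bijection public using (to; from)
  field
    ~-iff : ∀ u v → (u G.~ v) ⇔ (to u H.~ to v)

≅-refl : ∀ {G} → G ≅ G
≅-refl = record
  { bijection = Identity.↔-id _
  ; ~-iff     = λ _ _ → Identity.⇔-id _
  }

≅-sym : ∀ {G H} → G ≅ H → H ≅ G
≅-sym {G} {H} φ = record
  { bijection = Symmetry.↔-sym φ.bijection
  ; ~-iff     = λ u v → Symmetry.⇔-sym
      (subst₂ (λ x y → (φ.from u G.~ φ.from v) ⇔ (x H.~ y))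
        (Inverse.strictlyInverseˡ φ.bijection u)
        (Inverse.strictlyInverseˡ φ.bijection v)
        (φ.~-iff (φ.from u) (φ.from v)))
  }
  where
  module φ = _≅_ φ
  module G = Graph G
  module H = Graph H

≅-trans : ∀ {G H K} → G ≅ H → H ≅ K → G ≅ K
≅-trans φ ψ = record
  { bijection = ψ.bijection Compose.↔-∘ φ.bijection
  ; ~-iff     = λ u v → ψ.~-iff (φ.to u) (φ.to v) Compose.⇔-∘ φ.~-iff u v
  }
  where
  module φ = _≅_ φ
  module ψ = _≅_ ψ

graphSetoid : Setoid (lsuc 0ℓ) 0ℓ
graphSetoid = record
  { Carrier       = Graph
  ; _≈_           = _≅_
  ; isEquivalence = record { refl = ≅-refl ; sym = ≅-sym ; trans = ≅-trans }
  }

module _ (G : Graph) where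
  open Graph G using (_~_)

  data Walk : ℕ → V G → V G → Set where
    []  : ∀ {v} → Walk 0 v v
    _∷_ : ∀ {n u v w} → u ~ v → Walk n v w → Walk (suc n) u w

  Dist≤ : ℕ → V G → V G → Set
  Dist≤ r u v = ∃[ n ] n ℕ.≤ r × Walk n u v

  -- The null graph is not connected.
  Connected : Set
  Connected = V G × (∀ u v → ∃[ n ] Walk n u v)

  MaxDegree≤ : ℕ → Set
  MaxDegree≤ D = ∀ v → [ u ∈ V G ∣ v ~ u ] ↣ Fin D

  Infinite : Set
  Infinite = ¬ (∃[ n ] (V G ↔ Fin n))

  -- The refinement type has proof-irrelevant membership, so its elements
  -- are equal as soon as the underlying vertices are.
  induced : Pred (V G) 0ℓ → Graph
  induced P = record
    { V        = [ u ∈ V G ∣ P u ]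
    ; _~_      = _~_ on value
    ; ~-sym    = Graph.~-sym G
    ; ~-irrefl = λ x≡y → Graph.~-irrefl G (cong value x≡y)
    }

record RootedGraph : Set₁ where
  constructor rooted
  field
    graph : Graph
    root  : V graph

infix 4 _≅•_

_≅•_ : RootedGraph → RootedGraph → Set
rooted G v ≅• rooted H w = Σ (G ≅ H) λ φ → _≅_.to φ v ≡ w

B : ℕ → (G : Graph) → V G → RootedGraph
B r G v = rooted (induced G (Dist≤ G r v)) (v , [ 0 , z≤n , [] ])

-- A set of isomorphism classes of rooted graphs is represented by the
-- isomorphism-closed predicate it induces.
𝔅 : ℕ → Graph → Pred RootedGraph 0ℓ
𝔅 r G R = ∃[ v ] (R ≅• B r G v)

record 𝔊 (D : ℕ) : Set₁ where
  field
    graph      : Graph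
    connected  : Connected graph
    maxDegree≤ : MaxDegree≤ graph D

𝔊∞ : ℕ → Set₁
𝔊∞ D = Σ (𝔊 D) λ G → Infinite (𝔊.graph G)

𝔊-setoid 𝔊∞-setoid : ℕ → Setoid (lsuc 0ℓ) 0ℓ
𝔊-setoid  D = On.setoid graphSetoid (𝔊.graph {D})
𝔊∞-setoid D = On.setoid (𝔊-setoid D) (proj₁ {B = λ G → Infinite (𝔊.graph G)})

-- A rational greatest lower bound (among rationals) of a set of rationals
-- is also its infimum in the reals, by density.
record IsInfimum (S : Pred ℚ ℓ) (q : ℚ) : Set ℓ where
  field
    lowerBound : ∀ {s} → s ∈ S → q ℚ.≤ s
    greatest   : ∀ l → (∀ {s} → s ∈ S → l ℚ.≤ s) → l ℚ.≤ q

2⁻ : ℕ → ℚ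
2⁻ r = (ℤ.+ 1 / (2 ℕ.^ r)) {{ℕ.m^n≢0 2 r}}

agreement : Graph → Graph → Pred ℚ (lsuc 0ℓ)
agreement G H s = ∃[ r ] s ≡ 2⁻ r × 𝔅 r G ≐ 𝔅 r H

private
  1/-anti-≤ : ∀ j k .{{_ : ℕ.NonZero j}} .{{_ : ℕ.NonZero k}} →
              j ℕ.≤ k → ℤ.+ 1 / k ℚ.≤ ℤ.+ 1 / j
  1/-anti-≤ (suc j) (suc k) j≤k = ℚ.toℚᵘ-cancel-≤
    (ℚᵘ.≤-respˡ-≃ (ℚᵘ.≃-sym (ℚ.toℚᵘ-fromℚᵘ (ℚᵘ.mkℚᵘ (ℤ.+ 1) k)))
    (ℚᵘ.≤-respʳ-≃ (ℚᵘ.≃-sym (ℚ.toℚᵘ-fromℚᵘ (ℚᵘ.mkℚᵘ (ℤ.+ 1) j)))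
      (ℚᵘ.*≤* (ℤ.*-monoˡ-≤-nonNeg (ℤ.+ 1) (ℤ.+≤+ j≤k)))))

  1/-anti-< : ∀ j k .{{_ : ℕ.NonZero j}} .{{_ : ℕ.NonZero k}} →
              j ℕ.< k → ℤ.+ 1 / k ℚ.< ℤ.+ 1 / j
  1/-anti-< (suc j) (suc k) j<k = ℚ.toℚᵘ-cancel-<
    (ℚᵘ.<-respˡ-≃ (ℚᵘ.≃-sym (ℚ.toℚᵘ-fromℚᵘ (ℚᵘ.mkℚᵘ (ℤ.+ 1) k)))
    (ℚᵘ.<-respʳ-≃ (ℚᵘ.≃-sym (ℚ.toℚᵘ-fromℚᵘ (ℚᵘ.mkℚᵘ (ℤ.+ 1) j)))
      (ℚᵘ.*<* (ℤ.*-monoˡ-<-pos (ℤ.+ 1) (ℤ.+<+ j<k)))))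

  2⁻-anti-≤ : ∀ {r s} → r ℕ.≤ s → 2⁻ s ℚ.≤ 2⁻ r
  2⁻-anti-≤ {r} {s} r≤s =
    1/-anti-≤ (2 ℕ.^ r) (2 ℕ.^ s) {{ℕ.m^n≢0 2 r}} {{ℕ.m^n≢0 2 s}}
      (ℕ.^-monoʳ-≤ 2 r≤s)

  0≤2⁻ : ∀ r → 0ℚ ℚ.≤ 2⁻ r
  0≤2⁻ r = ℚ.nonNegative⁻¹ (2⁻ r)
    {{ℚ.normalize-nonNeg 1 (2 ℕ.^ r) {{ℕ.m^n≢0 2 r}}}}

  n<2^n : ∀ n → n ℕ.< 2 ℕ.^ n
  n<2^n zero    = s≤s z≤n
  n<2^n (suc n) = ℕ.≤-trans (ℕ.+-mono-≤ (ℕ.m^n>0 2 n) (n<2^n n))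
    (ℕ.+-monoʳ-≤ (2 ℕ.^ n) (ℕ.m≤m+n (2 ℕ.^ n) 0))

  archimedean : ∀ l → 0ℚ ℚ.< l → ∃[ d ] (∀ r → d ℕ.≤ r → 2⁻ r ℚ.< l)
  archimedean (mkℚ (ℤ.+ 0) _ _) (ℚ.*<* (ℤ.+<+ ()))
  archimedean (mkℚ ℤ.-[1+ _ ] _ _) (ℚ.*<* ())
  archimedean l@(mkℚ (ℤ.+ suc n) d _) _ = suc d , λ r d≤r →
    ℚ.<-≤-trans
      (1/-anti-< (suc d) (2 ℕ.^ r) {{_}} {{ℕ.m^n≢0 2 r}}
        (ℕ.<-≤-trans (n<2^n (suc d)) (ℕ.^-monoʳ-≤ 2 d≤r)))
      (ℚ.toℚᵘ-cancel-≤
        (ℚᵘ.≤-respˡ-≃ (ℚᵘ.≃-sym (ℚ.toℚᵘ-fromℚᵘ (ℚᵘ.mkℚᵘ (ℤ.+ 1) d)))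
          (ℚᵘ.*≤* (ℤ.*-monoʳ-≤-nonNeg (ℤ.+ suc d) (ℤ.+≤+ (s≤s (z≤n {n})))))))

module _ (X : Setoid a ℓ) where
  open Setoid X using (Carrier; _≈_)

  -- Requiring ε to be rational is no restriction, since ε may be decreased.
  StronglyIsolated : DistanceFunction Carrier → Pred Carrier (a ⊔ ℓ)
  StronglyIsolated d x =
    ∃[ ε ] 0ℚ ℚ.< ε × ¬ (∃[ x′ ] ¬ (x′ ≈ x) × d x x′ ℚ.≤ ε)

  CountablyInfinitelyMany : Pred Carrier p → Set (a ⊔ ℓ ⊔ p)
  CountablyInfinitelyMany P =
    Bijection (≡.setoid ℕ) (On.setoid X (proj₁ {B = P}))

-- Excluded middle is what makes the infimum exist; it equals 2⁻ʳ for the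
-- largest r at which the two graphs have the same r-balls, or 0 if there
-- is no largest such r.
module Classical (em : ExcludedMiddle (lsuc 0ℓ)) where

  private
    em₀ : ExcludedMiddle 0ℓ
    em₀ {P} with em {Level.Lift (lsuc 0ℓ) P}
    ... | yes (Level.lift x) = yes x
    ... | no ¬x              = no λ x → ¬x (Level.lift x)

    B₀-trivial : ∀ G v (x : V (RootedGraph.graph (B 0 G v))) →
                 x ≡ RootedGraph.root (B 0 G v)
    B₀-trivial G v (u , [ δ ]) with recompute em₀ δ
    ... | 0 , z≤n , [] = refl

    B₀-≅• : ∀ G H v w → B 0 G v ≅• B 0 H w
    B₀-≅• G H v w = record
      { bijection = mk↔ₛ′
          (λ _ → RootedGraph.root (B 0 H w))
          (λ _ → RootedGraph.root (B 0 G v))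
          (λ y → sym (B₀-trivial H w y))
          (λ x → sym (B₀-trivial G v x))
      ; ~-iff = λ x y → mk⇔
          (λ x~y → ⊥-elim (Graph.~-irrefl G
            (cong value (trans (B₀-trivial G v x) (sym (B₀-trivial G v y)))) x~y))
          (λ w~w → ⊥-elim (Graph.~-irrefl H refl w~w))
      } , refl

    ≅•-trans : ∀ {Q R S} → Q ≅• R → R ≅• S → Q ≅• S
    ≅•-trans (φ , φ-root) (ψ , ψ-root) =
      ≅-trans φ ψ , trans (cong (_≅_.to ψ) φ-root) ψ-root

    𝔅₀-≐ : ∀ {G H} → V G → V H → 𝔅 0 G ≐ 𝔅 0 H
    𝔅₀-≐ {G} {H} v₀ w₀ =
      (λ {R} (v , R≅B) → w₀ , ≅•-trans {R} R≅B (B₀-≅• G H v w₀)) ,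
      (λ {R} (w , R≅B) → v₀ , ≅•-trans {R} R≅B (B₀-≅• H G w v₀))

    maximum : (T : Pred ℕ (lsuc 0ℓ)) → T 0 → ∀ n → (∀ r → T r → r ℕ.≤ n) →
              ∃[ m ] T m × (∀ r → T r → r ℕ.≤ m)
    maximum T T0 zero    bound = 0 , T0 , bound
    maximum T T0 (suc n) bound with em {T (suc n)}
    ... | yes Tn = suc n , Tn , bound
    ... | no ¬Tn = maximum T T0 n λ r Tr → ℕ.s≤s⁻¹
          (ℕ.≤∧≢⇒< (bound r Tr) λ r≡1+n → ¬Tn (subst T r≡1+n Tr))

  infimum : ∀ {G H} → Connected G → Connected H → ∃ (IsInfimum (agreement G H))
  infimum {G} {H} (v , _) (w , _)
    with em {∃[ n ] (∀ r → 𝔅 r G ≐ 𝔅 r H → r ℕ.≤ n)}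
  ... | yes (n , bound)
    with m , Tm , m-max ←
           maximum (λ r → 𝔅 r G ≐ 𝔅 r H) (𝔅₀-≐ v w) n bound
    = 2⁻ m , record
        { lowerBound = λ { (r , refl , Tr) → 2⁻-anti-≤ (m-max r Tr) }
        ; greatest   = λ l l≤ → l≤ (m , refl , Tm)
        }
  ... | no unbounded = 0ℚ , record
        { lowerBound = λ { (r , refl , _) → 0≤2⁻ r }
        ; greatest   = λ l l≤ → ℚ.≮⇒≥ λ 0<l →
            let d , small = archimedean l 0<l in
            unbounded (d , λ r Tr → ℕ.≮⇒≥ λ d<r →
              ℚ.<-irrefl refl
                (ℚ.<-≤-trans (small r (ℕ.<⇒≤ d<r)) (l≤ (r , refl , Tr))))
        }

  dist : ∀ {D} → DistanceFunction (𝔊 D)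
  dist G H = proj₁ (infimum (𝔊.connected G) (𝔊.connected H))

  dist-isInfimum : ∀ {D} (G H : 𝔊 D) →
    IsInfimum (agreement (𝔊.graph G) (𝔊.graph H)) (dist G H)
  dist-isInfimum G H = proj₂ (infimum (𝔊.connected G) (𝔊.connected H))

  dist∞ : ∀ {D} → DistanceFunction (𝔊∞ D)
  dist∞ = dist on proj₁

open Classical public using (infimum; dist; dist-isInfimum; dist∞)

{-# OPTIONS --safe #-}

-- The isolated graphs are rays with a local orientation: the k-th one is a
-- path of k + 3 vertices followed by a spine whose vertices carry pendant
-- paths of lengths 1, 2, 0, 1, 2, 0, …  Since this pattern is chiral, balls of
-- large enough radius reveal the label of each vertex (its place in the
-- pattern, or on the initial path), hence which of its neighbours is its
-- parent.  A connected graph with the same balls inherits such labels, contains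
-- the start of the path, and in it every other vertex has a unique parent and
-- one child of each prescribed label; so it cannot close up into cycles and is
-- isomorphic to the given graph.
--
-- There are only countably many isolated points since each is determined by a
-- radius r and its set of r-balls, and bounded degree leaves finitely many
-- such sets for each r.
module Submission where

open import Defs
open import Axiom.ExcludedMiddle using (ExcludedMiddle)
open import Data.Fin.Base as Fin using (Fin; zero; suc; combine; remQuot; funToFin; finToFun)
import Data.Fin.Properties as Fin
import Data.Integer.Base as ℤ
import Data.Integer.Properties as ℤ
open import Data.Irrelevant using ([_])
open import Data.List.Base using (List; []; _∷_; _++_; map; length; lookup)
open import Data.List.Membership.Propositional using (_∈_)
open import Data.List.Membership.Propositional.Properties using (∈-∃++)
open import Data.List.Properties using (length-++)
import Data.List.Relation.Binary.Permutation.Propositional.Properties as Perm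
open import Data.List.Relation.Unary.All as All using ([]; _∷_)
open import Data.List.Relation.Unary.AllPairs using ([]; _∷_)
open import Data.List.Relation.Unary.Any as Any using (here; there)
open import Data.List.Relation.Unary.Any.Properties using (lookup-index)
open import Data.List.Relation.Unary.Unique.Propositional using (Unique)
open import Data.Nat.Base as ℕ using (ℕ; zero; suc; _+_; _*_; _^_; _≤_; _<_; z≤n; s≤s)
open import Data.Nat.Induction using (<-rec)
open import Data.Nat.ListAction using (sum)
open import Data.Nat.ListAction.Properties using (sum-↭)
import Data.Nat.Properties as ℕ
open import Data.Product.Base using (Σ; ∃; ∃-syntax; _×_; _,_; proj₁; proj₂)
open import Data.Rational.Base as ℚ using (0ℚ; mkℚ; _/_)
import Data.Rational.Properties as ℚ
import Data.Rational.Unnormalised.Base as ℚᵘ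
import Data.Rational.Unnormalised.Properties as ℚᵘ
open import Data.Refinement using (Refinement-syntax; value; _,_)
open import Data.Sum.Base using (_⊎_; inj₁; inj₂)
open import Function.Base using (_∘_; _on_; const; id)
open import Function.Bundles
  using (Bijection; Equivalence; Injection; Inverse; mk⇔; mk↔ₛ′; mk↣)
open import Level using (Level; 0ℓ; Lift; lift) renaming (suc to lsuc)
open import Relation.Binary.Bundles using (Setoid)
open import Relation.Binary.Construct.Closure.Symmetric as SymClosure
  using (SymClosure; fwd; bwd)
open import Relation.Binary.Definitions as Binary using (Asymmetric; tri<; tri≈; tri>)
open import Relation.Binary.PropositionalEquality
  using (_≡_; _≗_; refl; sym; trans; cong; cong₂; subst; subst₂)
import Relation.Binary.PropositionalEquality as ≡
open import Relation.Nullary using (¬_; yes; no; contradiction; recompute)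
open import Relation.Nullary.Decidable using (decidable-stable)
open import Relation.Unary using (Pred; _≐_)

private
  variable
    a p : Level
    G H K : Graph
    k k′ r s : ℕ

-- Walks and balls

value-injective : {A : Set a} {P : A → Set p} {x y : [ u ∈ A ∣ P u ]} →
                  value x ≡ value y → x ≡ y
value-injective {x = _ , _} {y = _ , _} refl = refl

_++ʷ_ : ∀ {u v w} → Walk G k u v → Walk G k′ v w → Walk G (k + k′) u w
[]       ++ʷ W′ = W′
(e ∷ W)  ++ʷ W′ = e ∷ (W ++ʷ W′)

reverseʷ : ∀ {u v} → Walk G k u v → Walk G k v u
reverseʷ []                  = []
reverseʷ {G} {suc k} {u} {v} (e ∷ W) =
  subst (λ k → Walk G k v u) (ℕ.+-comm k 1)
    (reverseʷ W ++ʷ (Graph.~-sym G e ∷ []))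

dist≤-refl : ∀ {v} → Dist≤ G r v v
dist≤-refl = 0 , z≤n , []

dist≤-trans : ∀ {u v w} → Dist≤ G r u v → Dist≤ G s v w → Dist≤ G (r + s) u w
dist≤-trans (k , k≤r , W) (l , l≤s , W′) = k + l , ℕ.+-mono-≤ k≤r l≤s , W ++ʷ W′

dist≤-weaken : ∀ {u v} → r ≤ s → Dist≤ G r u v → Dist≤ G s u v
dist≤-weaken r≤s (k , k≤r , W) = k , ℕ.≤-trans k≤r r≤s , W

edge⇒dist≤ : ∀ {u v} → Graph._~_ G u v → Dist≤ G 1 u v
edge⇒dist≤ e = 1 , s≤s z≤n , e ∷ []

≅•-sym : ∀ {Q R} → Q ≅• R → R ≅• Q
≅•-sym (φ , φ-root) = ≅-sym φ ,
  trans (cong (_≅_.from φ) (sym φ-root)) (Inverse.strictlyInverseʳ (_≅_.bijection φ) _)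

≅•-trans : ∀ {Q R S} → Q ≅• R → R ≅• S → Q ≅• S
≅•-trans (φ , φ-root) (ψ , ψ-root) =
  ≅-trans φ ψ , trans (cong (_≅_.to ψ) φ-root) ψ-root

-- A record rather than a synonym for ≅•, so that its arguments can be inferred.
record Sim (r : ℕ) (G : Graph) (v : Graph.V G) (H : Graph) (w : Graph.V H) : Set where
  constructor sim
  field
    ball≅ : B r G v ≅• B r H w

sim-sym : ∀ {v w} → Sim r G v H w → Sim r H w G v
sim-sym {r} {G} {H} {v} {w} (sim φ) = sim (≅•-sym {B r G v} {B r H w} φ)

sim-trans : ∀ {u v w} → Sim r G u H v → Sim r H v K w → Sim r G u K w
sim-trans {r} {G} {H} {K} {u} {v} {w} (sim φ) (sim ψ) =
  sim (≅•-trans {B r G u} {B r H v} {B r K w} φ ψ)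

module Ball {r : ℕ} {G H : Graph} {v : Graph.V G} {w : Graph.V H} (σ : Sim r G v H w) where
  private
    module G = Graph G
    module H = Graph H
    module φ = _≅_ (proj₁ (Sim.ball≅ σ))

  image : ∀ u → .(Dist≤ G r v u) → H.V
  image u δ = value (φ.to (u , [ δ ]))

  image-root : image v dist≤-refl ≡ w
  image-root = cong value (proj₂ (Sim.ball≅ σ))

  image-edge : ∀ {t u} → .(δ : Dist≤ G r v t) .(ε : Dist≤ G r v u) →
               t G.~ u → image t δ H.~ image u ε
  image-edge δ ε = Equivalence.to (φ.~-iff (_ , [ δ ]) (_ , [ ε ]))

  image-walk : ∀ {d k t u} → Dist≤ G d v t → (W : Walk G k t u) → d + k ≤ r →
               .(δ : Dist≤ G r v t) .(ε : Dist≤ G r v u) →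
               Walk H k (image t δ) (image u ε)
  image-walk           D []      d+k≤r δ ε = []
  image-walk {d} {suc k} D (e ∷ W) d+k≤r δ ε =
    image-edge δ (dist≤-weaken d+1≤r D′) e ∷ image-walk D′ W d+1+k≤r _ ε
    where
    D′ = dist≤-trans D (edge⇒dist≤ e)
    d+1+k≤r = ℕ.≤-trans (ℕ.≤-reflexive (ℕ.+-assoc d 1 k)) d+k≤r
    d+1≤r = ℕ.≤-trans (ℕ.m≤m+n (d + 1) k) d+1+k≤r

  image-dist≤ : ∀ {d s t u} → Dist≤ G d v t → Dist≤ G s t u → d + s ≤ r →
                .(δ : Dist≤ G r v t) .(ε : Dist≤ G r v u) →
                Dist≤ H s (image t δ) (image u ε)
  image-dist≤ {d} D (k , k≤s , W) d+s≤r δ ε =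
    k , k≤s , image-walk D W (ℕ.≤-trans (ℕ.+-monoʳ-≤ d k≤s) d+s≤r) δ ε

  image-dist≤-root : ∀ {d u} → Dist≤ G d v u → d ≤ r → .(δ : Dist≤ G r v u) →
                     Dist≤ H d w (image u δ)
  image-dist≤-root D d≤r δ =
    subst (λ x → Dist≤ H _ x _) image-root
      (image-dist≤ {d = 0} dist≤-refl D d≤r dist≤-refl δ)

module _ {r : ℕ} {G H : Graph} {v : Graph.V G} {w : Graph.V H} (σ : Sim r G v H w) where
  private
    module G = Graph G
    module H = Graph H
    module φ = _≅_ (proj₁ (Sim.ball≅ σ))
    module To = Ball σ
    module From = Ball (sim-sym σ)

    from-image : ∀ {u} .(δ : Dist≤ G r v u) .(ε : Dist≤ H r w (To.image u δ)) →
                 From.image (To.image u δ) ε ≡ u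
    from-image δ ε = cong value (Inverse.strictlyInverseʳ φ.bijection (_ , [ δ ]))

    image-from : ∀ {u} .(δ : Dist≤ H r w u) .(ε : Dist≤ G r v (From.image u δ)) →
                 To.image (From.image u δ) ε ≡ u
    image-from δ ε = cong value (Inverse.strictlyInverseˡ φ.bijection (_ , [ δ ]))

  -- Since d + s ≤ r, the s-ball about `u` lies in the r-ball about `v`, together with the walks
  -- that witness its distances. The isomorphism and its inverse carry these walks over, so both
  -- restrict to the s-balls about `u` and its image.
  sim-restrict : ∀ {d s u} → Dist≤ G d v u → d + s ≤ r →
                 .(δ : Dist≤ G r v u) → Sim s G u H (To.image u δ)
  sim-restrict {d} {s} {u} D d+s≤r δ = sim (record
    { bijection = mk↔ₛ′ to from
        (λ { (y , [ η ]) → value-injective (image-from (inᴴ η) _) })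
        (λ { (x , [ ξ ]) → value-injective (from-image (inᴳ ξ) _) })
    ; ~-iff = λ { (x , [ ξ ]) (y , [ η ]) → φ.~-iff (x , [ inᴳ ξ ]) (y , [ inᴳ η ]) }
    } , refl)
    where
    d≤r : d ≤ r
    d≤r = ℕ.≤-trans (ℕ.m≤m+n d s) d+s≤r
    Dᴴ : Dist≤ H d w (To.image u δ)
    Dᴴ = To.image-dist≤-root D d≤r δ
    inᴳ : ∀ {x} → Dist≤ G s u x → Dist≤ G r v x
    inᴳ ξ = dist≤-weaken d+s≤r (dist≤-trans D ξ)
    inᴴ : ∀ {x} → Dist≤ H s (To.image u δ) x → Dist≤ H r w x
    inᴴ ξ = dist≤-weaken d+s≤r (dist≤-trans Dᴴ ξ)
    to : Graph.V (induced G (Dist≤ G s u)) → Graph.V (induced H (Dist≤ H s (To.image u δ)))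
    to (x , [ ξ ]) = To.image x (inᴳ ξ) , [ To.image-dist≤ D ξ d+s≤r δ (inᴳ ξ) ]
    from : Graph.V (induced H (Dist≤ H s (To.image u δ))) → Graph.V (induced G (Dist≤ G s u))
    from (y , [ η ]) = From.image y (inᴴ η) ,
      [ subst (λ z → Dist≤ G s z (From.image y (inᴴ η))) (from-image δ (dist≤-weaken d≤r Dᴴ))
          (From.image-dist≤ Dᴴ η d+s≤r (dist≤-weaken d≤r Dᴴ) (inᴴ η)) ]

sim-weaken : ∀ {v w} → s ≤ r → Sim r G v H w → Sim s G v H w
sim-weaken {s = s} {G = G} {H = H} {v = v} s≤r σ =
  subst (Sim s G v H) (Ball.image-root σ)
    (sim-restrict σ {d = 0} dist≤-refl s≤r dist≤-refl)

𝔅⊆⇒sim : (∀ {R} → 𝔅 r G R → 𝔅 r H R) → ∀ v → ∃[ w ] Sim r G v H w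
𝔅⊆⇒sim {r} {G} ⊆ v = let w , φ = ⊆ {B r G v} (v , ≅-refl , refl) in w , sim φ

sim⇒𝔅⊆ : (∀ v → ∃[ w ] Sim r G v H w) → ∀ {R} → 𝔅 r G R → 𝔅 r H R
sim⇒𝔅⊆ {r} {G} {H} sims {R} (v , ψ) with w , sim φ ← sims v =
  w , ≅•-trans {R} {B r G v} {B r H w} ψ φ

𝔅-weaken : s ≤ r → 𝔅 r G ≐ 𝔅 r H → 𝔅 s G ≐ 𝔅 s H
𝔅-weaken {s} {r} {G} {H} s≤r (G⊆H , H⊆G) =
  (λ {R} → sim⇒𝔅⊆ {G = G} {H} (λ v → weaken (𝔅⊆⇒sim {G = G} {H} (λ {R} → G⊆H {R}) v)) {R}) ,
  (λ {R} → sim⇒𝔅⊆ {G = H} {G} (λ w → weaken (𝔅⊆⇒sim {G = H} {G} (λ {R} → H⊆G {R}) w)) {R})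
  where
  weaken : ∀ {G H v} → ∃[ w ] Sim r G v H w → ∃[ w ] Sim s G v H w
  weaken (w , σ) = w , sim-weaken s≤r σ

-- Passing to a neighbour costs one unit of radius: the neighbours of the two centres correspond
-- bijectively, and corresponding ones have isomorphic s-balls.
module Neighbours {s : ℕ} {G H : Graph} {v : Graph.V G} {w : Graph.V H}
                  (σ : Sim (suc s) G v H w) where
  private
    module G = Graph G
    module H = Graph H
    module φ = _≅_ (proj₁ (Sim.ball≅ σ))
    module To = Ball σ
    near : ∀ {u} → v G.~ u → Dist≤ G (suc s) v u
    near e = 1 , s≤s z≤n , e ∷ []

  abstract
    nbr : ∀ u → .(v G.~ u) → H.V
    nbr u e = To.image u (near e)

    nbr-cong : ∀ {t u} .(e : v G.~ t) .(f : v G.~ u) → t ≡ u → nbr t e ≡ nbr u f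
    nbr-cong e f refl = refl

    nbr-edge : ∀ {u} (e : v G.~ u) → w H.~ nbr u e
    nbr-edge e = subst (λ x → x H.~ nbr _ e) To.image-root (To.image-edge dist≤-refl (near e) e)

    nbr-sim : ∀ {u} (e : v G.~ u) → Sim s G u H (nbr u e)
    nbr-sim e = sim-restrict σ (edge⇒dist≤ e) ℕ.≤-refl (near e)

    nbr-surjective : ∀ {x} → w H.~ x → ∃[ u ] Σ (v G.~ u) λ e → nbr u e ≡ x
    nbr-surjective {x} e = value y , edge ,
      cong value (Inverse.strictlyInverseˡ φ.bijection (x , [ δ ]))
      where
      δ : Dist≤ H (suc s) w x
      δ = 1 , s≤s z≤n , e ∷ []
      y : Graph.V (induced G (Dist≤ G (suc s) v))
      y = φ.from (x , [ δ ])
      edge : v G.~ value y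
      edge = Equivalence.from (φ.~-iff _ y)
        (subst (λ t → t H.~ value (φ.to y)) (sym To.image-root)
          (subst (w H.~_)
            (sym (cong value (Inverse.strictlyInverseˡ φ.bijection (x , [ δ ])))) e))

    nbr-injective : ∀ {t u} .(e : v G.~ t) .(f : v G.~ u) → nbr t e ≡ nbr u f → t ≡ u
    nbr-injective {t} {u} e f eq = cong value (trans (sym (strictlyInverseʳ (t , [ near e ])))
      (trans (cong φ.from (value-injective {x = φ.to (t , [ near e ])} eq))
        (strictlyInverseʳ (u , [ near f ]))))
      where open Inverse φ.bijection using (strictlyInverseʳ)

-- Enumeration of countably infinite setoids

lower-em : ExcludedMiddle (lsuc 0ℓ) → ExcludedMiddle 0ℓ
lower-em em {P} with em {Lift (lsuc 0ℓ) P}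
... | yes (lift p) = yes p
... | no ¬p        = no λ p → ¬p (lift p)

module _ (em : ExcludedMiddle 0ℓ) where

  least : (Q : ℕ → Set) → ∃ Q → ∃[ n ] Q n × (∀ m → m < n → ¬ Q m)
  least Q (n , q) = <-rec (λ n → Q n → ∃[ n ] Q n × (∀ m → m < n → ¬ Q m)) descend n q
    where
    descend : ∀ n → (∀ {m} → m < n → Q m → ∃[ n ] Q n × (∀ m → m < n → ¬ Q m)) →
              Q n → ∃[ n ] Q n × (∀ m → m < n → ¬ Q m)
    descend n rec q with em {∃[ m ] m < n × Q m}
    ... | yes (m , m<n , q′) = rec m<n q′
    ... | no none            = n , q , λ m m<n q′ → none (m , m<n , q′)

  module _ (Q : ℕ → Set) (unbounded : ∀ N → ∃[ n ] N ≤ n × Q n) where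

    private
      next : ∀ N → ∃[ n ] (N ≤ n × Q n) × (∀ m → m < n → ¬ (N ≤ m × Q m))
      next N = least (λ n → N ≤ n × Q n) (unbounded N)

    enum : ℕ → ℕ
    enum zero    = proj₁ (next 0)
    enum (suc k) = proj₁ (next (suc (enum k)))

    enum-satisfies : ∀ k → Q (enum k)
    enum-satisfies zero    = proj₂ (proj₁ (proj₂ (next 0)))
    enum-satisfies (suc k) = proj₂ (proj₁ (proj₂ (next (suc (enum k)))))

    enum-step : ∀ k → enum k < enum (suc k)
    enum-step k = proj₁ (proj₁ (proj₂ (next (suc (enum k)))))

    enum-mono : ∀ {i j} → i < j → enum i < enum j
    enum-mono {i} {suc j} (s≤s i≤j) with ℕ.m≤n⇒m<n∨m≡n i≤j
    ... | inj₁ i<j  = ℕ.<-trans (enum-mono i<j) (enum-step j)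
    ... | inj₂ refl = enum-step j

    enum-injective : ∀ i j → enum i ≡ enum j → i ≡ j
    enum-injective i j eq with ℕ.<-cmp i j
    ... | tri< i<j _ _ = contradiction eq (ℕ.<⇒≢ (enum-mono i<j))
    ... | tri≈ _ i≡j _ = i≡j
    ... | tri> _ _ i>j = contradiction (sym eq) (ℕ.<⇒≢ (enum-mono i>j))

    enum-≥ : ∀ k → k ≤ enum k
    enum-≥ zero    = z≤n
    enum-≥ (suc k) = ℕ.≤-<-trans (enum-≥ k) (enum-step k)

    -- `n` lies below `enum (suc n)`. Going down from there, `n` is either an entry or falls into a
    -- gap before one, where the minimality of `next` excludes elements of `Q`.
    enum-surjective : ∀ {n} → Q n → ∃[ k ] enum k ≡ n
    enum-surjective {n} q = below (suc n) (enum-≥ (suc n))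
      where
      below : ∀ k → n < enum k → ∃[ k ] enum k ≡ n
      below zero    n<e = contradiction (z≤n , q) (proj₂ (proj₂ (next 0)) n n<e)
      below (suc k) n<e with ℕ.<-cmp n (enum k)
      ... | tri< n<ek _ _ = below k n<ek
      ... | tri≈ _ refl _ = k , refl
      ... | tri> _ _ n>ek =
        contradiction (n>ek , q) (proj₂ (proj₂ (next (suc (enum k)))) n n<e)

module _ (em : ExcludedMiddle (lsuc 0ℓ)) (S : Setoid (lsuc 0ℓ) 0ℓ) where
  open Setoid S renaming (refl to ≈-refl; sym to ≈-sym; trans to ≈-trans)

  private
    em₀ : ExcludedMiddle 0ℓ
    em₀ = lower-em em

  -- Each class is represented by the least number that decodes to it. Codes separate classes but
  -- may vary within one, so a class can be decoded from several numbers; `New` keeps one of them,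
  -- and the kept numbers are enumerated in increasing order.
  countablyInfinite : (code : Carrier → ℕ) → (∀ {x y} → code x ≡ code y → x ≈ y) →
                      (f : ℕ → Carrier) → (∀ {m n} → f m ≈ f n → m ≡ n) →
                      Bijection (≡.setoid ℕ) S
  countablyInfinite code code-injective f f-injective = record
    { to        = λ k → decode (e k)
    ; cong      = λ { refl → ≈-refl }
    ; bijective = injective , surjective
    }
    where
    decode : ℕ → Carrier
    decode n with em {∃[ x ] code x ≡ n}
    ... | yes (x , _) = x
    -- Any class serves for a number that codes nothing, since `New` discards repetitions.
    ... | no _        = f 0

    decode-code : ∀ x → decode (code x) ≈ x
    decode-code x with em {∃[ y ] code y ≡ code x}
    ... | yes (_ , eq) = code-injective eq
    ... | no none      = contradiction (x , refl) none

    New : ℕ → Set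
    New n = ∀ m → m < n → ¬ decode m ≈ decode n

    represent : ∀ x → ∃[ n ] New n × decode n ≈ x
    represent x with n , eq , minimal ← least em₀ (λ n → decode n ≈ x) (code x , decode-code x) =
      n , (λ m m<n m≈n → minimal m m<n (≈-trans m≈n eq)) , eq

    unbounded : ∀ N → ∃[ n ] N ≤ n × New n
    unbounded N with em₀ {∃[ n ] N ≤ n × New n}
    ... | yes found = found
    ... | no none   =
      -- Were all new numbers below `N`, two of `f 0`, ..., `f N` would share their representative
      -- and be equivalent.
      let index : ℕ → Fin N
          index i = let n , new , _ = represent (f i) in
            Fin.fromℕ< (ℕ.≰⇒> λ N≤n → none (n , N≤n , new))
          i , j , i<j , eq = Fin.pigeonhole (ℕ.n<1+n N) (λ i → index (Fin.toℕ i))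
      in contradiction
        (f-injective (≈-trans (≈-sym (proj₂ (proj₂ (represent (f (Fin.toℕ i))))))
          (≈-trans (reflexive (cong decode (Fin.fromℕ<-injective _ _ _ _ eq)))
            (proj₂ (proj₂ (represent (f (Fin.toℕ j))))))))
        (ℕ.<⇒≢ i<j)

    e : ℕ → ℕ
    e = enum em₀ New unbounded

    injective : ∀ {i j} → decode (e i) ≈ decode (e j) → i ≡ j
    injective {i} {j} eq with ℕ.<-cmp (e i) (e j)
    ... | tri< ei<ej _ _ = contradiction eq (enum-satisfies em₀ New unbounded j _ ei<ej)
    ... | tri≈ _ ei≡ej _ = enum-injective em₀ New unbounded i j ei≡ej
    ... | tri> _ _ ei>ej = contradiction (≈-sym eq) (enum-satisfies em₀ New unbounded i _ ei>ej)

    surjective : ∀ x → ∃[ k ] (∀ {j} → j ≡ k → decode (e j) ≈ x)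
    surjective x with n , new , eq ← represent x
      with k , refl ← enum-surjective em₀ New unbounded new = k , λ { refl → eq }

-- Strong isolation in terms of balls

1/-anti-< : ∀ j k .{{_ : ℕ.NonZero j}} .{{_ : ℕ.NonZero k}} →
            j < k → ℤ.+ 1 / k ℚ.< ℤ.+ 1 / j
1/-anti-< (suc j) (suc k) j<k = ℚ.toℚᵘ-cancel-< (begin-strict
  ℚ.toℚᵘ (ℤ.+ 1 / suc k)  ≃⟨ ℚ.toℚᵘ-fromℚᵘ (ℚᵘ.mkℚᵘ (ℤ.+ 1) k) ⟩
  ℚᵘ.mkℚᵘ (ℤ.+ 1) k       <⟨ ℚᵘ.*<* (ℤ.*-monoˡ-<-pos (ℤ.+ 1) (ℤ.+<+ j<k)) ⟩
  ℚᵘ.mkℚᵘ (ℤ.+ 1) j       ≃⟨ ℚ.toℚᵘ-fromℚᵘ (ℚᵘ.mkℚᵘ (ℤ.+ 1) j) ⟨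
  ℚ.toℚᵘ (ℤ.+ 1 / suc j)  ∎)
  where open ℚᵘ.≤-Reasoning

2⁻-anti-< : ∀ {r s} → r < s → 2⁻ s ℚ.< 2⁻ r
2⁻-anti-< {r} {s} r<s = 1/-anti-< (2 ^ r) (2 ^ s) {{ℕ.m^n≢0 2 r}} {{ℕ.m^n≢0 2 s}}
  (ℕ.^-monoʳ-< 2 (s≤s (s≤s z≤n)) r<s)

2⁻-anti-≤ : ∀ {r s} → r ≤ s → 2⁻ s ℚ.≤ 2⁻ r
2⁻-anti-≤ {r} {s} r≤s with r ℕ.≟ s
... | yes refl = ℚ.≤-refl
... | no r≢s   = ℚ.<⇒≤ (2⁻-anti-< (ℕ.≤∧≢⇒< r≤s r≢s))

0<2⁻ : ∀ r → 0ℚ ℚ.< 2⁻ r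
0<2⁻ r = ℚ.positive⁻¹ (2⁻ r) {{ℚ.normalize-pos 1 (2 ^ r) {{ℕ.m^n≢0 2 r}}}}

n<2^n : ∀ n → n < 2 ^ n
n<2^n zero    = s≤s z≤n
n<2^n (suc n) = begin-strict
  suc n          <⟨ s≤s (n<2^n n) ⟩
  suc (2 ^ n)    ≤⟨ ℕ.+-monoˡ-≤ (2 ^ n) (ℕ.m^n>0 2 n) ⟩
  2 ^ n + 2 ^ n  ≡⟨ cong (2 ^ n +_) (ℕ.+-identityʳ (2 ^ n)) ⟨
  2 ^ suc n      ∎
  where open ℕ.≤-Reasoning

-- With ε = (n + 1) / (d + 1), already 1 / (d + 1) is at most ε, and 2 ^ (d + 1) exceeds d + 1.
2⁻-archimedean : ∀ ε → 0ℚ ℚ.< ε → ∃[ r ] 2⁻ r ℚ.≤ ε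
2⁻-archimedean (mkℚ (ℤ.+ 0) _ _) (ℚ.*<* (ℤ.+<+ ()))
2⁻-archimedean (mkℚ ℤ.-[1+ _ ] _ _) (ℚ.*<* ())
2⁻-archimedean ε@(mkℚ (ℤ.+ suc n) d _) _ = suc d , ℚ.≤-trans
  (ℚ.<⇒≤ (1/-anti-< (suc d) (2 ^ suc d) {{_}} {{ℕ.m^n≢0 2 (suc d)}} (n<2^n (suc d))))
  (ℚ.toℚᵘ-cancel-≤ (begin
    ℚ.toℚᵘ (ℤ.+ 1 / suc d)    ≃⟨ ℚ.toℚᵘ-fromℚᵘ (ℚᵘ.mkℚᵘ (ℤ.+ 1) d) ⟩
    ℚᵘ.mkℚᵘ (ℤ.+ 1) d         ≤⟨ ℚᵘ.*≤* (ℤ.*-monoʳ-≤-nonNeg (ℤ.+ suc d) (ℤ.+≤+ (s≤s (z≤n {n})))) ⟩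
    ℚᵘ.mkℚᵘ (ℤ.+ suc n) d     ∎))
  where open ℚᵘ.≤-Reasoning

-- The carrier is abstract so that one argument serves both `𝔊-setoid` and `𝔊∞-setoid`.
module _ (em : ExcludedMiddle (lsuc 0ℓ)) {D : ℕ}
         (X : Setoid (lsuc 0ℓ) 0ℓ) (⌊_⌋ : Setoid.Carrier X → 𝔊 D) where
  open Setoid X using (Carrier; _≈_)

  private
    graph : Carrier → Graph
    graph x = 𝔊.graph ⌊ x ⌋

  Determined : ℕ → Carrier → Set₁
  Determined r x = ∀ y → 𝔅 r (graph x) ≐ 𝔅 r (graph y) → y ≈ x

  isolated⇒determined : ∀ {x} → StronglyIsolated X (dist em on ⌊_⌋) x → ∃[ r ] Determined r x
  isolated⇒determined {x} (ε , 0<ε , isolated) = let r , 2⁻r≤ε = 2⁻-archimedean ε 0<ε in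
    r , λ y agree → decidable-stable (lower-em em) λ y≉x → isolated (y , y≉x ,
      ℚ.≤-trans (IsInfimum.lowerBound (dist-isInfimum em ⌊ x ⌋ ⌊ y ⌋) (r , refl , agree)) 2⁻r≤ε)

  -- A graph that agrees with `x` at some radius beyond `r` agrees at `r` too and is then equivalent
  -- to `x`. For all others the radii of agreement are at most `r`, so the distance is at least
  -- `2⁻ r`, which exceeds the chosen ε.
  determined⇒isolated : ∀ {r x} → Determined r x → StronglyIsolated X (dist em on ⌊_⌋) x
  determined⇒isolated {r} {x} determined = 2⁻ (suc r) , 0<2⁻ (suc r) , λ (y , y≉x , d≤) →
    ℚ.<-irrefl refl (begin-strict
      2⁻ (suc r)            <⟨ 2⁻-anti-< {r} {suc r} ℕ.≤-refl ⟩
      2⁻ r                  ≤⟨ IsInfimum.greatest (dist-isInfimum em ⌊ x ⌋ ⌊ y ⌋) (2⁻ r)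
                                 (λ { (s , refl , agree) → 2⁻-anti-≤ (ℕ.≮⇒≥ λ r<s →
                                   y≉x (determined y
                                     (𝔅-weaken {G = graph x} {graph y} (ℕ.<⇒≤ r<s) agree))) }) ⟩
      dist em ⌊ x ⌋ ⌊ y ⌋   ≤⟨ d≤ ⟩
      2⁻ (suc r)            ∎)
    where open ℚ.≤-Reasoning

-- Finiteness of the set of r-balls for each degree bound

funToFin-injective : ∀ {m n} {f g : Fin m → Fin n} → funToFin f ≡ funToFin g → f ≗ g
funToFin-injective {f = f} {g} eq i = trans (sym (Fin.finToFun-funToFin f i))
  (trans (cong (λ c → finToFun c i) eq) (Fin.finToFun-funToFin g i))

-- This is 2^m (2n + 1); parity separates the two clauses, which makes it injective.
pair : ℕ → ℕ → ℕ
pair zero    n = suc (2 * n)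
pair (suc m) n = 2 * pair m n

pair-injective : ∀ m n {m′ n′} → pair m n ≡ pair m′ n′ → m ≡ m′ × n ≡ n′
pair-injective zero    n {zero}   {n′} eq = refl , ℕ.*-cancelˡ-≡ n n′ 2 (ℕ.suc-injective eq)
pair-injective zero    n {suc m′} {n′} eq = contradiction (sym eq) (ℕ.even≢odd (pair m′ n′) n)
pair-injective (suc m) n {zero}   {n′} eq = contradiction eq (ℕ.even≢odd (pair m n) n′)
pair-injective (suc m) n {suc m′} {n′} eq =
  let m≡ , n≡ = pair-injective m n (ℕ.*-cancelˡ-≡ (pair m n) (pair m′ n′) 2 eq)
  in  cong suc m≡ , n≡

-- The walk that takes port 0 at each step; it singles out the root among the coded vertices.
stay : ∀ {d} r → Fin (suc d ^ r)
stay     zero    = zero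
stay {d} (suc r) = combine {suc d} zero (stay r)

module _ (em : ExcludedMiddle 0ℓ) where

  bit : Set → Fin 2
  bit P with em {P}
  ... | yes _ = suc zero
  ... | no  _ = zero

  bit-resp : ∀ {P Q} → bit P ≡ bit Q → P → Q
  bit-resp {P} {Q} eq p with em {P} | em {Q}
  ... | no ¬p | _     = contradiction p ¬p
  ... | yes _ | yes q = q

  module Exploration {D : ℕ} (G : Graph) (ports : MaxDegree≤ G D) where
    open Graph G

    -- Port 0 stays put, so that walks shorter than r are covered as well.
    move : V → Fin (suc D) → V
    move v zero    = v
    move v (suc i) with em {∃[ u ] Σ (v ~ u) λ e → Injection.to (ports v) (u , [ e ]) ≡ i}
    ... | yes (u , _) = u
    ... | no _        = v

    move-dist≤ : ∀ v p → Dist≤ G 1 v (move v p)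
    move-dist≤ v zero    = 0 , z≤n , []
    move-dist≤ v (suc i) with em {∃[ u ] Σ (v ~ u) λ e → Injection.to (ports v) (u , [ e ]) ≡ i}
    ... | yes (u , e , _) = edge⇒dist≤ e
    ... | no _            = 0 , z≤n , []

    move-covers : ∀ {v u} → v ~ u → ∃[ p ] move v p ≡ u
    move-covers {v} {u} e = suc i , covers
      where
      i = Injection.to (ports v) (u , [ e ])
      covers : move v (suc i) ≡ u
      covers with em {∃[ u′ ] Σ (v ~ u′) λ e → Injection.to (ports v) (u′ , [ e ]) ≡ i}
      ... | yes (_ , _ , eq) = cong value (Injection.injective (ports v) eq)
      ... | no none          = contradiction (u , e , refl) none

    explore : ∀ r → V → Fin (suc D ^ r) → V
    explore zero    v _ = v
    explore (suc r) v i = let p , j = remQuot {suc D} (suc D ^ r) i in explore r (move v p) j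

    explore-combine : ∀ r v p j → explore (suc r) v (combine p j) ≡ explore r (move v p) j
    explore-combine r v p j = cong (λ pj → explore r (move v (proj₁ pj)) (proj₂ pj))
      (Fin.remQuot-combine {suc D} {suc D ^ r} p j)

    explore-dist≤ : ∀ r v i → Dist≤ G r v (explore r v i)
    explore-dist≤ zero    v _ = dist≤-refl
    explore-dist≤ (suc r) v i = let p , j = remQuot {suc D} (suc D ^ r) i in
      dist≤-trans (move-dist≤ v p) (explore-dist≤ r (move v p) j)

    explore-walk : ∀ r {k v u} → k ≤ r → Walk G k v u → ∃[ i ] explore r v i ≡ u
    explore-walk zero    z≤n [] = zero , refl
    explore-walk (suc r) _   [] with j , eq ← explore-walk r z≤n [] =
      combine {suc D} zero j , trans (explore-combine r _ zero j) eq
    explore-walk (suc r) (s≤s k≤r) (e ∷ W)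
      with p , refl ← move-covers e with j , eq ← explore-walk r k≤r W =
      combine p j , trans (explore-combine r _ p j) eq

    explore-covers : ∀ r {v u} → Dist≤ G r v u → ∃[ i ] explore r v i ≡ u
    explore-covers r (k , k≤r , W) = explore-walk r k≤r W

    explore-stay : ∀ r v → explore r v (stay r) ≡ v
    explore-stay zero    v = refl
    explore-stay (suc r) v = trans (explore-combine r v zero (stay r)) (explore-stay r v)

    -- A table of equalities and adjacencies between the vertices reached by the coded walks; its
    -- size depends on `D` and `r` only. The choice of ports may change the code of a ball, but
    -- equal codes force isomorphic balls.
    ballCode : ∀ r → V → Fin (((2 * 2) ^ (suc D ^ r)) ^ (suc D ^ r))
    ballCode r v = funToFin λ i → funToFin λ j →
      combine (bit (explore r v i ≡ explore r v j)) (bit (explore r v i ~ explore r v j))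

    -- The characteristic function of the set of ball codes that occur, so `D` and `r` leave
    -- finitely many values.
    familyCode : ∀ r → Fin (2 ^ (((2 * 2) ^ (suc D ^ r)) ^ (suc D ^ r)))
    familyCode r = funToFin λ c → bit (∃[ v ] ballCode r v ≡ c)

  module _ {D r : ℕ} {G H : Graph} (ports : MaxDegree≤ G D) (ports′ : MaxDegree≤ H D) where
    private
      module G where
        open Graph G public
        open Exploration G ports public
      module H where
        open Graph H public
        open Exploration H ports′ public

    -- The vertex reached by a coded walk in one graph is sent to the vertex reached by the same
    -- walk in the other. Equal tables make this independent of the walk, bijective and faithful to
    -- edges, and the walk that stays put matches the roots.
    ballCode-injective : ∀ {v w} → G.ballCode r v ≡ H.ballCode r w → Sim r G v H w
    ballCode-injective {v} {w} eq = sim (record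
      { bijection = mk↔ₛ′ to from
          (λ { (y , [ δ ]) → value-injective (trans
            (same-vertex (proj₂ (G-covers (G.explore-dist≤ r v (proj₁ (H-covers δ))))))
            (proj₂ (H-covers δ))) })
          (λ { (x , [ δ ]) → value-injective (trans
            (same-vertex⁻ (proj₂ (H-covers (H.explore-dist≤ r w (proj₁ (G-covers δ))))))
            (proj₂ (G-covers δ))) })
      ; ~-iff = λ { (x , [ δ ]) (y , [ ε ]) → mk⇔
          (λ e → proj₂ (agree _ _)
            (subst₂ G._~_ (sym (proj₂ (G-covers δ))) (sym (proj₂ (G-covers ε))) e))
          (λ e → subst₂ G._~_ (proj₂ (G-covers δ)) (proj₂ (G-covers ε)) (proj₂ (agree⁻ _ _) e)) }
      } , value-injective (trans
            (same-vertex (trans (proj₂ (G-covers dist≤-refl)) (sym (G.explore-stay r v))))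
            (H.explore-stay r w)))
      where
      codes : ∀ i j →
        bit (G.explore r v i ≡ G.explore r v j) ≡ bit (H.explore r w i ≡ H.explore r w j) ×
        bit (G.explore r v i G.~ G.explore r v j) ≡ bit (H.explore r w i H.~ H.explore r w j)
      codes i j = Fin.combine-injective _ _ _ _ (funToFin-injective (funToFin-injective eq i) j)
      agree : ∀ i j → (G.explore r v i ≡ G.explore r v j → H.explore r w i ≡ H.explore r w j) ×
                      (G.explore r v i G.~ G.explore r v j → H.explore r w i H.~ H.explore r w j)
      agree i j = bit-resp (proj₁ (codes i j)) , bit-resp (proj₂ (codes i j))
      agree⁻ : ∀ i j → (H.explore r w i ≡ H.explore r w j → G.explore r v i ≡ G.explore r v j) ×
                       (H.explore r w i H.~ H.explore r w j → G.explore r v i G.~ G.explore r v j)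
      agree⁻ i j = bit-resp (sym (proj₁ (codes i j))) , bit-resp (sym (proj₂ (codes i j)))
      same-vertex : ∀ {i j} → G.explore r v i ≡ G.explore r v j → H.explore r w i ≡ H.explore r w j
      same-vertex = proj₁ (agree _ _)
      same-vertex⁻ : ∀ {i j} → H.explore r w i ≡ H.explore r w j → G.explore r v i ≡ G.explore r v j
      same-vertex⁻ = proj₁ (agree⁻ _ _)
      -- Membership in a ball is irrelevant; excluded middle recovers a walk from it.
      G-covers : ∀ {u} → .(Dist≤ G r v u) → ∃[ i ] G.explore r v i ≡ u
      G-covers δ = G.explore-covers r (recompute em δ)
      H-covers : ∀ {u} → .(Dist≤ H r w u) → ∃[ i ] H.explore r w i ≡ u
      H-covers δ = H.explore-covers r (recompute em δ)
      to : Graph.V (induced G (Dist≤ G r v)) → Graph.V (induced H (Dist≤ H r w))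
      to (x , [ δ ]) = H.explore r w (proj₁ (G-covers δ)) , [ H.explore-dist≤ r w _ ]
      from : Graph.V (induced H (Dist≤ H r w)) → Graph.V (induced G (Dist≤ G r v))
      from (y , [ δ ]) = G.explore r v (proj₁ (H-covers δ)) , [ G.explore-dist≤ r v _ ]

  familyCode-⊆ : ∀ {D r G H} (ports : MaxDegree≤ G D) (ports′ : MaxDegree≤ H D) →
    Exploration.familyCode G ports r ≡ Exploration.familyCode H ports′ r →
    ∀ {R} → 𝔅 r G R → 𝔅 r H R
  familyCode-⊆ {D} {r} {G} {H} ports ports′ eq {R} = sim⇒𝔅⊆ {G = G} {H} (λ v →
    let w , code≡ = bit-resp (funToFin-injective eq (Exploration.ballCode G ports r v)) (v , refl)
    in w , ballCode-injective ports ports′ (sym code≡)) {R}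

  familyCode-injective : ∀ {D r G H} (ports : MaxDegree≤ G D) (ports′ : MaxDegree≤ H D) →
    Exploration.familyCode G ports r ≡ Exploration.familyCode H ports′ r → 𝔅 r G ≐ 𝔅 r H
  familyCode-injective {G = G} {H} ports ports′ eq =
    (λ {R} → familyCode-⊆ {G = G} {H} ports ports′ eq {R}) ,
    (λ {R} → familyCode-⊆ {G = H} {G} ports′ ports (sym eq) {R})

-- Trees unfolding a labelled digraph

module Unfolding {L : Set} (_⇒_ : L → L → Set)
  (⇒-asym : Asymmetric _⇒_) (start : L) where

  infixl 5 _▸_

  -- Nodes are the directed walks from `start`, so a cycle of the digraph unrolls into an infinite
  -- path.
  data Node : L → Set where
    root : Node start
    _▸_  : ∀ {x y} → Node x → x ⇒ y → Node y

  data _⟶_ : Σ L Node → Σ L Node → Set where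
    child : ∀ {x y} (ν : Node x) (e : x ⇒ y) → (x , ν) ⟶ (y , ν ▸ e)

  ⟶⇒ : ∀ {v w} → v ⟶ w → proj₁ v ⇒ proj₁ w
  ⟶⇒ (child ν e) = e

  tree : Graph
  tree = record
    { V        = Σ L Node
    ; _~_      = SymClosure _⟶_
    ; ~-sym    = SymClosure.symmetric _⟶_
    ; ~-irrefl = λ { refl (fwd e) → ⇒-asym (⟶⇒ e) (⟶⇒ e)
                   ; refl (bwd e) → ⇒-asym (⟶⇒ e) (⟶⇒ e) }
    }

  open Graph tree using (_~_)

  origin : Graph.V tree
  origin = start , root

  walk-from-root : ∀ {x} (ν : Node x) → ∃[ k ] Walk tree k origin (x , ν)
  walk-from-root root    = 0 , []
  walk-from-root (ν ▸ e) with k , W ← walk-from-root ν =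
    k + 1 , W ++ʷ (fwd (child ν e) ∷ [])

  connected : Connected tree
  connected = origin , λ { (x , ν) (y , μ) →
    _ , reverseʷ (proj₂ (walk-from-root ν)) ++ʷ proj₂ (walk-from-root μ) }

  ~⇒ : ∀ {v w} → v ~ w → proj₁ v ⇒ proj₁ w ⊎ proj₁ w ⇒ proj₁ v
  ~⇒ (fwd e) = inj₁ (⟶⇒ e)
  ~⇒ (bwd e) = inj₂ (⟶⇒ e)

  -- By asymmetry the labels of its ends orient an edge, so a neighbour whose label precedes that of
  -- `v` can only be the node that `v` extends.
  ~-parent-unique : ∀ {u u′ v} → v ~ u → v ~ u′ →
                    proj₁ u ⇒ proj₁ v → proj₁ u′ ⇒ proj₁ v → u ≡ u′
  ~-parent-unique (fwd d)           _                 u⇒v _    = contradiction u⇒v (⇒-asym (⟶⇒ d))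
  ~-parent-unique (bwd _)           (fwd d)           _   u′⇒v = contradiction u′⇒v (⇒-asym (⟶⇒ d))
  ~-parent-unique (bwd (child ν e)) (bwd (child ν e)) _   _    = refl

  module _ (⇒-irrelevant : Binary.Irrelevant _⇒_) where

    ~-label-injective : ∀ {u u′ v} → v ~ u → v ~ u′ → proj₁ u ≡ proj₁ u′ → u ≡ u′
    ~-label-injective (fwd (child ν d)) (fwd (child ν e)) refl
      rewrite ⇒-irrelevant d e = refl
    ~-label-injective (fwd d) (bwd e) refl = contradiction (⟶⇒ e) (⇒-asym (⟶⇒ d))
    ~-label-injective (bwd d) v~u′    refl
      = ~-parent-unique (bwd d) v~u′ (⟶⇒ d) (⟶⇒ d)

  -- Local conditions under which a connected graph is a copy of the tree. `Label` is a relation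
  -- because labels will be read off from similarity to some node.
  record Labelling (H : Graph) : Set₁ where
    private
      module H = Graph H
    field
      Label       : L → H.V → Set
      label       : ∀ w → ∃[ x ] Label x w
      label-unique : ∀ {x y w} → Label x w → Label y w → x ≡ y
      start-vertex : ∃[ w ] Label start w
      start-orphan : ∀ {w u y} → Label start w → w H.~ u → Label y u → ¬ y ⇒ start
      child-vertex : ∀ {x y w} → Label x w → x ⇒ y → ∃[ u ] w H.~ u × Label y u
      adjacent    : ∀ {x y w u} → Label x w → w H.~ u → Label y u → x ⇒ y ⊎ y ⇒ x
      child-unique : ∀ {x y w u u′} → Label x w →
                     w H.~ u → w H.~ u′ → Label y u → Label y u′ → u ≡ u′
      parent-unique : ∀ {x y y′ w u u′} → Label x w → w H.~ u → w H.~ u′ →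
                      Label y u → Label y′ u′ → y ⇒ x → y′ ⇒ x → u ≡ u′

    image : ∀ {x} → Node x → ∃ (Label x)
    image root    = start-vertex
    image (ν ▸ e) with u , _ , ℓ ← child-vertex (proj₂ (image ν)) e = u , ℓ

    image-edge : ∀ {x y} (ν : Node x) (e : x ⇒ y) →
                 proj₁ (image ν) H.~ proj₁ (image (ν ▸ e))
    image-edge ν e = proj₁ (proj₂ (child-vertex (proj₂ (image ν)) e))

    to : Graph.V tree → H.V
    to (x , ν) = proj₁ (image ν)

    to-label : ∀ v → Label (proj₁ v) (to v)
    to-label (x , ν) = proj₂ (image ν)

    -- Edges lift: a neighbour with a succeeding label is the image of a child, one with a preceding
    -- label is the image of the parent, and `start-orphan` rules out the latter at the root.
    to-neighbour : ∀ v {u} → to v H.~ u → ∃[ w ] v ~ w × to w ≡ u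
    to-neighbour (x , ν) {u} w~u with y , ℓ ← label u with adjacent (to-label (x , ν)) w~u ℓ
    ... | inj₁ x⇒y = (y , ν ▸ x⇒y) , fwd (child ν x⇒y) ,
      child-unique (to-label (x , ν)) (image-edge ν x⇒y) w~u (proj₂ (image (ν ▸ x⇒y))) ℓ
    to-neighbour (x , root) w~u | inj₂ y⇒x =
      contradiction y⇒x (start-orphan (to-label origin) w~u ℓ)
    to-neighbour (x , ν ▸ e) w~u | inj₂ y⇒x = (_ , ν) , bwd (child ν e) ,
      parent-unique (to-label (x , ν ▸ e)) (H.~-sym (image-edge ν e)) w~u
        (proj₂ (image ν)) ℓ e y⇒x

    to-surjective : Connected H → ∀ w → ∃[ v ] to v ≡ w
    to-surjective (_ , conn) w = along origin (proj₂ (conn (to origin) w))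
      where
      along : ∀ {k w} v → Walk H k (to v) w → ∃[ v ] to v ≡ w
      along v []      = v , refl
      along v (e ∷ W) with v′ , _ , refl ← to-neighbour v e = along v′ W

    module _ (⇒-irrelevant : Binary.Irrelevant _⇒_) where

      -- Nodes with the same image have the same label, and `parent-unique` makes the images of
      -- their parents coincide, so the claim descends to the parents; `start-orphan` keeps the root
      -- apart from other nodes. This is what rules out cycles.
      to-injective : ∀ {x y} (ν : Node x) (μ : Node y) →
                     to (x , ν) ≡ to (y , μ) → (x , ν) ≡ (y , μ)
      to-injective {x} {y} ν μ eq
        with refl ← label-unique (proj₂ (image ν)) (subst (Label y) (sym eq) (proj₂ (image μ)))
        = same ν μ eq
        where
        same : ∀ {x} (ν μ : Node x) → to (x , ν) ≡ to (x , μ) → (x , ν) ≡ (x , μ)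
        same root root eq = refl
        same root (μ ▸ d) eq = contradiction d
          (start-orphan (subst (Label _) (sym eq) (proj₂ (image (μ ▸ d))))
            (subst (λ w → w H.~ to (_ , μ)) (sym eq) (H.~-sym (image-edge μ d))) (proj₂ (image μ)))
        same (ν ▸ e) root eq = contradiction e
          (start-orphan (subst (Label _) eq (proj₂ (image (ν ▸ e))))
            (subst (λ w → w H.~ to (_ , ν)) eq (H.~-sym (image-edge ν e))) (proj₂ (image ν)))
        same (ν ▸ e) (μ ▸ d) eq
          with refl ← to-injective ν μ
                 (parent-unique (proj₂ (image (ν ▸ e))) (H.~-sym (image-edge ν e))
                   (subst (λ w → w H.~ to (_ , μ)) (sym eq) (H.~-sym (image-edge μ d)))
                   (proj₂ (image ν)) (proj₂ (image μ)) e d)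
          with refl ← ⇒-irrelevant e d = refl

      tree≅ : Connected H → tree ≅ H
      tree≅ conn = record
        { bijection = mk↔ₛ′ to (λ w → proj₁ (to-surjective conn w))
            (λ w → proj₂ (to-surjective conn w))
            (λ v → to-inj (proj₂ (to-surjective conn (to v))))
        ; ~-iff = λ v w → mk⇔ preserve reflect
        }
        where
        to-inj : ∀ {v w} → to v ≡ to w → v ≡ w
        to-inj {_ , ν} {_ , μ} = to-injective ν μ
        preserve : ∀ {v w} → v ~ w → to v H.~ to w
        preserve (fwd (child ν e)) = image-edge ν e
        preserve (bwd (child ν e)) = H.~-sym (image-edge ν e)
        reflect : ∀ {v w} → to v H.~ to w → v ~ w
        reflect {v} e with w′ , v~w′ , eq ← to-neighbour v e =
          subst (v ~_) (to-inj eq) v~w′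

  Detects : ℕ → Set
  Detects s = ∀ {v w} → Sim s tree v tree w → proj₁ v ≡ proj₁ w

  module _ (⇒-irrelevant : Binary.Irrelevant _⇒_)
           (start-source : ∀ {x} → Node x → ¬ x ⇒ start)
           {s : ℕ} (detects : Detects s) where

    -- Radius `s` reads a label, and one more unit lets a vertex see the labels of its neighbours;
    -- the conditions then transfer from the tree through the matching of neighbours.
    labelling : ∀ {H} → 𝔅 (suc s) tree ≐ 𝔅 (suc s) H → Labelling H
    labelling {H} (tree⊆H , H⊆tree) = record
      { Label         = Label
      ; label         = λ w → let (x , ν) , σ = similar w in x , ν , σ
      ; label-unique  = λ (ν , σ) (μ , τ) → unique (weaken σ) (weaken τ)
      ; start-vertex  = let w , σ = 𝔅⊆⇒sim {G = tree} {H} (λ {R} → tree⊆H {R}) origin in w , root , σ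
      ; start-orphan  = λ (ν , σ) e ℓ → start-source (proj₁ (match σ e ℓ))
      ; child-vertex  = λ (ν , σ) x⇒y → let d = fwd (child ν x⇒y) in
          Neighbours.nbr σ _ d , Neighbours.nbr-edge σ d , promote (Neighbours.nbr-sim σ d)
      ; adjacent      = λ (ν , σ) e ℓ → ~⇒ (proj₁ (proj₂ (match σ e ℓ)))
      ; child-unique  = λ (ν , σ) e e′ ℓ ℓ′ →
          match-unique σ e e′ ℓ ℓ′ λ d d′ → ~-label-injective ⇒-irrelevant d d′ refl
      ; parent-unique = λ (ν , σ) e e′ ℓ ℓ′ y⇒x y′⇒x →
          match-unique σ e e′ ℓ ℓ′ λ d d′ → ~-parent-unique d d′ y⇒x y′⇒x
      }
      where
      module H = Graph H

      Label : L → H.V → Set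
      Label x w = Σ (Node x) λ ν → Sim (suc s) tree (x , ν) H w

      similar : ∀ w → ∃[ v ] Sim (suc s) tree v H w
      similar w = let v , σ = 𝔅⊆⇒sim {G = H} {tree} (λ {R} → H⊆tree {R}) w in v , sim-sym σ

      weaken : ∀ {w v} → Sim (suc s) tree v H w → Sim s tree v H w
      weaken = sim-weaken (ℕ.n≤1+n s)

      unique : ∀ {v v′ w} → Sim s tree v H w → Sim s tree v′ H w → proj₁ v ≡ proj₁ v′
      unique σ τ = detects (sim-trans σ (sim-sym τ))

      relabel : ∀ {v v′ w} → Sim (suc s) tree v H w → Sim s tree v′ H w → Label (proj₁ v′) w
      relabel {x , ν} {w = w} τ σ = subst (λ y → Label y w) (unique (weaken τ) σ) (ν , τ)

      -- Similarity at radius `s` suffices for a label: `H⊆tree` supplies some node similar at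
      -- radius s + 1, and detection shows that its label is the same. Hence the radius lost in
      -- passing to a neighbour is regained.
      promote : ∀ {v w} → Sim s tree v H w → Label (proj₁ v) w
      promote {w = w} σ = relabel (proj₂ (similar w)) σ

      Match : ∀ {v w} → Sim (suc s) tree v H w → H.V → L → Set
      Match {v} σ u y = Σ (Node y) λ μ → Σ (v ~ (y , μ)) λ d → Neighbours.nbr σ (y , μ) d ≡ u

      -- The neighbour of `v` that corresponds to `u` is similar to `u` at radius `s`, so detection
      -- forces its label to be `y`.
      match : ∀ {v w u y} (σ : Sim (suc s) tree v H w) → w H.~ u → Label y u → Match σ u y
      match {u = u} σ e (κ , τ) = go (Neighbours.nbr-surjective σ e)
        where
        go : ∃[ t ] Σ (_ ~ t) (λ d → Neighbours.nbr σ t d ≡ u) → Match σ u _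
        go ((z , μ) , d , eq) = subst (Match σ u)
          (unique (subst (Sim s tree (z , μ) H) eq (Neighbours.nbr-sim σ d)) (weaken τ))
          (μ , d , eq)

      match-unique : ∀ {v w u u′ y y′} (σ : Sim (suc s) tree v H w) → w H.~ u → w H.~ u′ →
        Label y u → Label y′ u′ →
        (∀ {μ : Node y} {μ′ : Node y′} → v ~ (y , μ) → v ~ (y′ , μ′) → (y , μ) ≡ (y′ , μ′)) →
        u ≡ u′
      match-unique σ e e′ ℓ ℓ′ same =
        let μ , d , eq     = match σ e ℓ
            μ′ , d′ , eq′ = match σ e′ ℓ′
        in trans (sym eq) (trans (Neighbours.nbr-cong σ d d′ (same d d′)) eq′)

    rigid : ∀ {H} → Connected H → 𝔅 (suc s) tree ≐ 𝔅 (suc s) H → tree ≅ H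
    rigid conn ≐ = Labelling.tree≅ (labelling ≐) ⇒-irrelevant conn

-- Vertex colours seen by balls

-- `R` matches the entries of `xs` with distinct entries of `ys` of equal value. The partner of the
-- head is removed from `ys`; as `xs` has no repetitions and `R` is injective, the tail is still
-- matched within what remains.
sum-map-mono : ∀ {a b r} {A : Set a} {B : Set b} (R : A → B → Set r)
  (f : A → ℕ) (g : B → ℕ) →
  (∀ {x x′ y} → R x y → R x′ y → x ≡ x′) →
  ∀ {xs ys} → Unique xs →
  (∀ {x} → x ∈ xs → ∃[ y ] y ∈ ys × R x y × f x ≡ g y) →
  sum (map f xs) ≤ sum (map g ys)
sum-map-mono R f g inj {[]}     _           match = z≤n
sum-map-mono R f g inj {x ∷ xs} {ys} (x∉xs ∷ xs!) match
  with y , y∈ , Rxy , fx≡gy ← match (here refl)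
  with ys₁ , ys₂ , refl ← ∈-∃++ y∈ = begin
  f x + sum (map f xs)            ≤⟨ ℕ.+-mono-≤ (ℕ.≤-reflexive fx≡gy)
                                       (sum-map-mono R f g inj xs! match′) ⟩
  g y + sum (map g (ys₁ ++ ys₂))  ≡⟨ sum-↭ (Perm.map⁺ g (Perm.shift y ys₁ ys₂)) ⟨
  sum (map g (ys₁ ++ y ∷ ys₂))    ∎
  where
  open ℕ.≤-Reasoning
  match′ : ∀ {x} → x ∈ xs → ∃[ y ] y ∈ ys₁ ++ ys₂ × R x y × f x ≡ g y
  match′ x∈ with y′ , y′∈ , Rxy′ , eq ← match (there x∈)
    with Perm.∈-resp-↭ (Perm.shift y ys₁ ys₂) y′∈
  ... | here refl  = contradiction (inj Rxy Rxy′) (All.lookup x∉xs x∈)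
  ... | there y′∈′ = y′ , y′∈′ , Rxy′ , eq

record NeighbourLists (G : Graph) : Set where
  open Graph G
  field
    neighbours : V → List V
    sound      : ∀ {v u} → u ∈ neighbours v → v ~ u
    complete   : ∀ {v u} → v ~ u → u ∈ neighbours v
    unique     : ∀ v → Unique (neighbours v)

  sum-over-neighbours : (V → ℕ) → V → ℕ
  sum-over-neighbours c v = sum (map c (neighbours v))

module _ {G H : Graph} (NG : NeighbourLists G) (NH : NeighbourLists H) where
  private
    module G = NeighbourLists NG
    module H = NeighbourLists NH

  sum-over-neighbours-mono : ∀ {s} (c : Graph.V G → ℕ) (c′ : Graph.V H → ℕ) →
    (∀ {v w} → Sim s G v H w → c v ≡ c′ w) →
    ∀ {v w} → Sim (suc s) G v H w → G.sum-over-neighbours c v ≤ H.sum-over-neighbours c′ w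
  sum-over-neighbours-mono c c′ local {v} {w} σ =
    sum-map-mono (λ u x → Σ (Graph._~_ G v u) λ e → N.nbr u e ≡ x) c c′
      (λ (e , p) (e′ , p′) → N.nbr-injective e e′ (trans p (sym p′)))
      (G.unique v)
      λ u∈ → let e = G.sound u∈ in
        N.nbr _ e , H.complete (N.nbr-edge e) , (e , refl) , local (N.nbr-sim e)
    where module N = Neighbours σ

-- One round of colour refinement: a colour readable from s-balls gives a sum readable from (s +
-- 1)-balls. Similarity is symmetric, so the inequality holds both ways.
sum-over-neighbours-local : ∀ {G H s} (NG : NeighbourLists G) (NH : NeighbourLists H)
  (c : Graph.V G → ℕ) (c′ : Graph.V H → ℕ) →
  (∀ {v w} → Sim s G v H w → c v ≡ c′ w) →
  ∀ {v w} → Sim (suc s) G v H w →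
  NeighbourLists.sum-over-neighbours NG c v ≡ NeighbourLists.sum-over-neighbours NH c′ w
sum-over-neighbours-local NG NH c c′ local σ = ℕ.≤-antisym
  (sum-over-neighbours-mono NG NH c c′ local σ)
  (sum-over-neighbours-mono NH NG c′ c (λ τ → sym (local (sim-sym τ))) (sim-sym σ))

≅⇒sim : ∀ {G H} (φ : G ≅ H) → ∀ r v → Sim r G v H (_≅_.to φ v)
≅⇒sim {G} {H} φ r v = sim (record
  { bijection = mk↔ₛ′
      (λ { (x , [ ξ ]) → φ.to x , [ to-dist≤ ξ ] })
      (λ { (y , [ η ]) → φ.from y ,
        [ subst (λ z → Dist≤ G r z (φ.from y)) (strictlyInverseʳ v) (from-dist≤ η) ] })
      (λ { (y , _) → value-injective (strictlyInverseˡ y) })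
      (λ { (x , _) → value-injective (strictlyInverseʳ x) })
  ; ~-iff = λ { (x , _) (y , _) → φ.~-iff x y }
  } , refl)
  where
  module φ = _≅_ φ
  open Inverse φ.bijection using (strictlyInverseˡ; strictlyInverseʳ)
  walk : ∀ {G H} (φ : G ≅ H) {k u v} → Walk G k u v → Walk H k (_≅_.to φ u) (_≅_.to φ v)
  walk φ []      = []
  walk φ (e ∷ W) = Equivalence.to (_≅_.~-iff φ _ _) e ∷ walk φ W
  to-dist≤ : ∀ {u v} → Dist≤ G r u v → Dist≤ H r (φ.to u) (φ.to v)
  to-dist≤ (k , k≤r , W) = k , k≤r , walk φ W
  from-dist≤ : ∀ {u v} → Dist≤ H r u v → Dist≤ G r (φ.from u) (φ.from v)
  from-dist≤ (k , k≤r , W) = k , k≤r , walk (≅-sym φ) W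

-- The isolated graphs

-- spineᵢ carries a pendant path with i edges (hair₁; hair₂ and tip₂).  The stem
-- is numbered backwards, from the spine to the start of the graph.
data Label : Set where
  stem : ℕ → Label
  spine₀ spine₁ spine₂ hair₁ hair₂ tip₂ : Label

data _⇒_ : Label → Label → Set where
  stem⇒   : ∀ {j} → stem (suc j) ⇒ stem j
  stem⇒₁  : stem 0 ⇒ spine₁
  spine₁⇒ : spine₁ ⇒ spine₂
  spine₂⇒ : spine₂ ⇒ spine₀
  spine₀⇒ : spine₀ ⇒ spine₁
  hair₁⇒  : spine₁ ⇒ hair₁
  hair₂⇒  : spine₂ ⇒ hair₂
  tip₂⇒   : hair₂ ⇒ tip₂

stem-child : ∀ j → ∃[ x ] stem j ⇒ x
stem-child zero    = _ , stem⇒₁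
stem-child (suc _) = _ , stem⇒

⇒-asym : Asymmetric _⇒_
⇒-asym stem⇒ ()
⇒-asym stem⇒₁ ()
⇒-asym spine₁⇒ ()
⇒-asym spine₂⇒ ()
⇒-asym spine₀⇒ ()
⇒-asym hair₁⇒ ()
⇒-asym hair₂⇒ ()
⇒-asym tip₂⇒ ()

⇒-irrelevant : Binary.Irrelevant _⇒_
⇒-irrelevant stem⇒ stem⇒ = refl
⇒-irrelevant stem⇒₁ stem⇒₁ = refl
⇒-irrelevant spine₁⇒ spine₁⇒ = refl
⇒-irrelevant spine₂⇒ spine₂⇒ = refl
⇒-irrelevant spine₀⇒ spine₀⇒ = refl
⇒-irrelevant hair₁⇒ hair₁⇒ = refl
⇒-irrelevant hair₂⇒ hair₂⇒ = refl
⇒-irrelevant tip₂⇒ tip₂⇒ = refl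

-- The arguments are the degree, the sum of the squared degrees of the
-- neighbours, and the sum of these sums over the neighbours.  They determine the
-- label, except that all of stem 1, stem 2, … fall into one class.
kind : ℕ → ℕ → ℕ → Label
kind 1 9  _  = hair₁
kind 1 4  10 = tip₂
kind 2 10 _  = hair₂
kind 2 13 _  = stem 0
kind 2 18 _  = spine₀
kind 3 14 _  = spine₁
kind 3 17 _  = spine₂
kind _ _  _  = stem 1

shape : Label → Label
shape (stem (suc _)) = stem 1
shape x              = x

-- A shorter stem would start at a vertex with the values of hair₁ or tip₂.
module Caterpillar (k : ℕ) where

  open Unfolding _⇒_ ⇒-asym (stem (2 + k)) public

  above : ∀ {x} → Node x → List (Graph.V tree)
  above root    = []
  above (ν ▸ _) = (_ , ν) ∷ []

  below : ∀ {x} → Node x → List (Graph.V tree)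
  below {stem j}       ν = (_ , ν ▸ proj₂ (stem-child j)) ∷ []
  below {spine₀}       ν = (_ , ν ▸ spine₀⇒) ∷ []
  below {spine₁}       ν = (_ , ν ▸ spine₁⇒) ∷ (_ , ν ▸ hair₁⇒) ∷ []
  below {spine₂}       ν = (_ , ν ▸ spine₂⇒) ∷ (_ , ν ▸ hair₂⇒) ∷ []
  below {hair₁}        ν = []
  below {hair₂}        ν = (_ , ν ▸ tip₂⇒) ∷ []
  below {tip₂}         ν = []

  adj : Graph.V tree → List (Graph.V tree)
  adj (_ , ν) = above ν ++ below ν

  ∈-below : ∀ {x y} (ν : Node x) (e : x ⇒ y) → (y , ν ▸ e) ∈ below ν
  ∈-below ν stem⇒   = here refl
  ∈-below ν stem⇒₁  = here refl
  ∈-below ν spine₁⇒ = here refl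
  ∈-below ν spine₂⇒ = here refl
  ∈-below ν spine₀⇒ = here refl
  ∈-below ν hair₁⇒  = there (here refl)
  ∈-below ν hair₂⇒  = there (here refl)
  ∈-below ν tip₂⇒   = here refl

  below-sound : ∀ {x} (ν : Node x) {u} → u ∈ below ν → (x , ν) ⟶ u
  below-sound {stem _}       ν (here refl) = child ν _
  below-sound {spine₀}       ν (here refl) = child ν _
  below-sound {spine₁}       ν (here refl) = child ν _
  below-sound {spine₁}       ν (there (here refl)) = child ν _
  below-sound {spine₂}       ν (here refl) = child ν _
  below-sound {spine₂}       ν (there (here refl)) = child ν _
  below-sound {hair₂}        ν (here refl) = child ν _

  below-unique : ∀ {x} (ν : Node x) → Unique (below ν)
  below-unique {stem _}       ν = [] ∷ []
  below-unique {spine₀}       ν = [] ∷ []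
  below-unique {spine₁}       ν = ((λ ()) ∷ []) ∷ [] ∷ []
  below-unique {spine₂}       ν = ((λ ()) ∷ []) ∷ [] ∷ []
  below-unique {hair₁}        ν = []
  below-unique {hair₂}        ν = [] ∷ []
  below-unique {tip₂}         ν = []

  neighbourLists : NeighbourLists tree
  neighbourLists = record
    { neighbours = adj ; sound = sound ; complete = complete ; unique = unique }
    where
    open Graph tree using (_~_)
    sound : ∀ {v u} → u ∈ adj v → v ~ u
    sound {_ , root}  u∈          = fwd (below-sound root u∈)
    sound {_ , ν ▸ e} (here refl) = bwd (child ν e)
    sound {_ , ν ▸ e} (there u∈)  = fwd (below-sound (ν ▸ e) u∈)
    complete : ∀ {v u} → v ~ u → u ∈ adj v
    complete (fwd (child root e))    = ∈-below root e
    complete (fwd (child (ν ▸ d) e)) = there (∈-below (ν ▸ d) e)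
    complete (bwd (child ν e))       = here refl
    unique : ∀ v → Unique (adj v)
    unique (_ , root)  = below-unique root
    unique (_ , ν ▸ e) = All.tabulate (λ u∈ → λ { refl → ⇒-asym e (⟶⇒ (below-sound (ν ▸ e) u∈)) })
      ∷ below-unique (ν ▸ e)

  open NeighbourLists neighbourLists public using (sum-over-neighbours)

  degree degree-squares square-sums : Graph.V tree → ℕ
  degree         = sum-over-neighbours (const 1)
  degree-squares = sum-over-neighbours (λ u → degree u * degree u)
  square-sums         = sum-over-neighbours degree-squares

  -- The sums look at most three edges away. Each clause exposes enough ancestors for `kind` to
  -- evaluate; `spine₁` and what hangs close to it split according to whether the spine is entered
  -- from the stem or from `spine₀`.
  kind-shape : ∀ v → kind (degree v) (degree-squares v) (square-sums v) ≡ shape (proj₁ v)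
  kind-shape (stem 0 , root ▸ ())
  kind-shape (stem 0 , _ ▸ stem⇒ ▸ stem⇒) = refl
  kind-shape (stem 1 , root ▸ stem⇒) = refl
  kind-shape (stem 1 , _ ▸ stem⇒ ▸ stem⇒) = refl
  kind-shape (stem (suc (suc j)) , root) = refl
  kind-shape (stem (suc (suc j)) , root ▸ stem⇒) = refl
  kind-shape (stem (suc (suc j)) , _ ▸ _ ▸ stem⇒) = refl
  kind-shape (spine₀ , _ ▸ spine₁⇒ ▸ spine₂⇒) = refl
  kind-shape (spine₁ , _ ▸ stem⇒ ▸ stem⇒₁) = refl
  kind-shape (spine₁ , _ ▸ spine₂⇒ ▸ spine₀⇒) = refl
  kind-shape (spine₂ , _ ▸ stem⇒₁ ▸ spine₁⇒) = refl
  kind-shape (spine₂ , _ ▸ spine₀⇒ ▸ spine₁⇒) = refl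
  kind-shape (hair₁ , _ ▸ stem⇒₁ ▸ hair₁⇒) = refl
  kind-shape (hair₁ , _ ▸ spine₀⇒ ▸ hair₁⇒) = refl
  kind-shape (hair₂ , _ ▸ spine₁⇒ ▸ hair₂⇒) = refl
  kind-shape (tip₂ , _ ▸ spine₁⇒ ▸ hair₂⇒ ▸ tip₂⇒) = refl

open Caterpillar using
  (tree; Node; root; _▸_; child; neighbourLists; adj; degree; degree-squares; square-sums)

-- Reading labels from balls

module _ {k k′ : ℕ} where

  degree-local : ∀ {v w} → Sim 1 (tree k) v (tree k′) w → degree k v ≡ degree k′ w
  degree-local = sum-over-neighbours-local {s = 0} (neighbourLists k) (neighbourLists k′) _ _
    (const refl)

  degree-squares-local : ∀ {v w} → Sim 2 (tree k) v (tree k′) w →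
                         degree-squares k v ≡ degree-squares k′ w
  degree-squares-local = sum-over-neighbours-local (neighbourLists k) (neighbourLists k′) _ _
    (λ σ → cong₂ _*_ (degree-local σ) (degree-local σ))

  square-sums-local : ∀ {v w} → Sim 3 (tree k) v (tree k′) w → square-sums k v ≡ square-sums k′ w
  square-sums-local = sum-over-neighbours-local (neighbourLists k) (neighbourLists k′) _ _
    degree-squares-local

  shape-local : ∀ {v w} → Sim 3 (tree k) v (tree k′) w → shape (proj₁ v) ≡ shape (proj₁ w)
  shape-local {v} {w} σ = trans (sym (Caterpillar.kind-shape k v))
    (trans (kind-cong (degree-local (sim-weaken (s≤s z≤n) σ))
                      (degree-squares-local (sim-weaken (s≤s (s≤s z≤n)) σ))
                      (square-sums-local σ))
      (Caterpillar.kind-shape k′ w))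
    where
    kind-cong : ∀ {d d′ q q′ t t′} → d ≡ d′ → q ≡ q′ → t ≡ t′ → kind d q t ≡ kind d′ q′ t′
    kind-cong refl refl refl = refl

shape≡stem₀ : ∀ {x} → shape x ≡ stem 0 → x ≡ stem 0
shape≡stem₀ {stem zero} _ = refl

stem-adjacent : ∀ i {x} → x ⇒ stem i ⊎ stem i ⇒ x → shape x ≡ stem 1 →
                x ≡ stem (suc i) ⊎ ∃[ j ] i ≡ suc j × x ≡ stem j
stem-adjacent i             (inj₁ stem⇒) _ = inj₁ refl
stem-adjacent (suc (suc i)) (inj₂ stem⇒) _ = inj₂ (_ , refl , refl)

-- Each stem vertex costs one unit of radius beyond the 3 needed for shapes. By induction `w` has a
-- neighbour labelled `stem i`, and its shape leaves the two sides of that neighbour along the stem.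
-- The two trees may differ, which later distinguishes them.
detect-stem : ∀ i {k k′ v w} → Sim (3 + i) (tree k) v (tree k′) w →
              proj₁ v ≡ stem i → proj₁ w ≡ stem i
detect-stem zero σ refl = shape≡stem₀ (sym (shape-local σ))
detect-stem (suc i) {k} {k′} {_ , ν} {w} σ refl = finish (stem-adjacent i
  (subst (λ x → proj₁ w ⇒ x ⊎ x ⇒ proj₁ w) u≡stem (Caterpillar.~⇒ k′ w~u))
  (sym (shape-local (sim-weaken (ℕ.m≤m+n 3 (suc i)) σ))))
  where
  module N = Neighbours σ
  e : Graph._~_ (tree k) (_ , ν) (_ , ν ▸ stem⇒)
  e = fwd (child ν stem⇒)
  w~u = N.nbr-edge e
  u≡stem : proj₁ (N.nbr _ e) ≡ stem i
  u≡stem = detect-stem i (N.nbr-sim e) refl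
  finish : proj₁ w ≡ stem (suc i) ⊎ ∃[ j ] i ≡ suc j × proj₁ w ≡ stem j →
           proj₁ w ≡ stem (suc i)
  finish (inj₁ w≡)              = w≡
  -- Here `v` has label `stem (2 + j)`. Applied from `w` to `v`, the claim for `j` would give it the
  -- label `stem j`.
  finish (inj₂ (j , refl , w≡)) = contradiction
    (detect-stem j (sim-weaken (ℕ.+-monoʳ-≤ 3 (ℕ.m≤n+m j 2)) (sim-sym σ)) w≡) λ ()

stem-bound : ∀ {k i} → Node k (stem i) → i ≤ 2 + k
stem-bound root          = ℕ.≤-refl
stem-bound (ν ▸ stem⇒)   = ℕ.≤-trans (ℕ.n≤1+n _) (stem-bound ν)

start-source : ∀ {k x} → Node k x → ¬ x ⇒ stem (2 + k)
start-source ν stem⇒ = ℕ.1+n≰n (stem-bound ν)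

shape-cases : ∀ x → x ≡ shape x ⊎ ∃[ i ] x ≡ stem (suc i)
shape-cases (stem zero)    = inj₁ refl
shape-cases (stem (suc i)) = inj₂ (i , refl)
shape-cases spine₀         = inj₁ refl
shape-cases spine₁         = inj₁ refl
shape-cases spine₂         = inj₁ refl
shape-cases hair₁          = inj₁ refl
shape-cases hair₂          = inj₁ refl
shape-cases tip₂           = inj₁ refl

-- Shapes need radius 3 and recognising `stem i` needs 3 + i. Stem indices are at most 2 + k, so 5 +
-- k suffices for every label.
detects : ∀ k → Caterpillar.Detects k (5 + k)
detects k {x , ν} {y , μ} σ with shape-cases x | shape-cases y
... | inj₁ x≡ | inj₁ y≡ = trans x≡
  (trans (shape-local (sim-weaken (ℕ.m≤m+n 3 (2 + k)) σ)) (sym y≡))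
... | inj₂ (i , refl) | _ =
  sym (detect-stem (suc i) (sim-weaken (ℕ.+-monoʳ-≤ 3 (stem-bound ν)) σ) refl)
... | inj₁ _ | inj₂ (i , refl) =
  detect-stem (suc i) (sim-weaken (ℕ.+-monoʳ-≤ 3 (stem-bound μ)) (sim-sym σ)) refl

caterpillar-rigid : ∀ k {H} → Connected H → 𝔅 (6 + k) (tree k) ≐ 𝔅 (6 + k) H → tree k ≅ H
caterpillar-rigid k = Caterpillar.rigid k ⇒-irrelevant start-source (detects k)

-- An isomorphism preserves balls of every radius, so the image of the origin is again labelled
-- `stem (2 + k)`; the other tree has such a node only if its own stem is at least as long.
caterpillar-injective : ∀ {k k′} → tree k ≅ tree k′ → k ≡ k′
caterpillar-injective φ = ℕ.≤-antisym (bound φ) (bound (≅-sym φ))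
  where
  bound : ∀ {k k′} → tree k ≅ tree k′ → k ≤ k′
  bound {k} φ = ℕ.+-cancelˡ-≤ 2 _ _ (stem-bound (subst (Node _)
    (detect-stem (2 + k) (≅⇒sim φ (5 + k) (Caterpillar.origin k)) refl)
    (proj₂ (_≅_.to φ (Caterpillar.origin k)))))

-- Degree bound and infinitude

length-adj : ∀ {k} v → length (adj k v) ≤ 3
length-adj {k} (_ , ν) = ℕ.≤-trans
  (ℕ.≤-reflexive (length-++ (Caterpillar.above k ν)))
  (ℕ.+-mono-≤ (above-length ν) (below-length ν))
  where
  above-length : ∀ {x} (ν : Node k x) → length (Caterpillar.above k ν) ≤ 1
  above-length root    = z≤n
  above-length (_ ▸ _) = s≤s z≤n
  below-length : ∀ {x} (ν : Node k x) → length (Caterpillar.below k ν) ≤ 2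
  below-length {stem _} ν = s≤s z≤n
  below-length {spine₀} ν = s≤s z≤n
  below-length {spine₁} ν = ℕ.≤-refl
  below-length {spine₂} ν = ℕ.≤-refl
  below-length {hair₁}  ν = z≤n
  below-length {hair₂}  ν = s≤s z≤n
  below-length {tip₂}   ν = z≤n

neighbourLists⇒maxDegree≤ : ExcludedMiddle 0ℓ → ∀ {G D} (N : NeighbourLists G) →
  (∀ v → length (NeighbourLists.neighbours N v) ≤ D) → MaxDegree≤ G D
neighbourLists⇒maxDegree≤ em {G} {D} N short v = mk↣ {to = port} port-injective
  where
  open NeighbourLists N
  at : ∀ {u} → .(Graph._~_ G v u) → u ∈ neighbours v
  at e = complete (recompute em e)
  port : [ u ∈ Graph.V G ∣ Graph._~_ G v u ] → Fin D
  port (u , [ e ]) = Fin.inject≤ (Any.index (at e)) (short v)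
  port-injective : ∀ {x y} → port x ≡ port y → x ≡ y
  port-injective {t , [ d ]} {u , [ e ]} eq = value-injective (trans (lookup-index (at d))
    (trans (cong (lookup (neighbours v)) (Fin.inject≤-injective (short v) (short v) _ _ eq))
      (sym (lookup-index (at e)))))

injection⇒infinite : ∀ {G} (f : ℕ → Graph.V G) → (∀ {m n} → f m ≡ f n → m ≡ n) → Infinite G
injection⇒infinite f f-injective (n , bij)
  with i , j , i<j , eq ← Fin.pigeonhole (ℕ.n<1+n n) (λ i → Inverse.to bij (f (Fin.toℕ i)))
  = ℕ.<⇒≢ i<j (f-injective (trans (sym (strictlyInverseʳ _))
      (trans (cong from eq) (strictlyInverseʳ _))))
  where open Inverse bij using (from; strictlyInverseʳ)

module _ {k : ℕ} where

  parent : Graph.V (tree k) → Graph.V (tree k)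
  parent (_ , ν ▸ _)  = _ , ν
  parent v@(_ , root) = v

  stem-end : ∀ {i} → Node k (stem i) → Node k (stem 0)
  stem-end {zero}  ν = ν
  stem-end {suc i} ν = stem-end (ν ▸ stem⇒)

  spine-node : ℕ → Node k spine₁
  spine-node zero    = stem-end root ▸ stem⇒₁
  spine-node (suc n) = spine-node n ▸ spine₁⇒ ▸ spine₂⇒ ▸ spine₀⇒

  spine-vertex : ℕ → Graph.V (tree k)
  spine-vertex n = spine₁ , spine-node n

  spine-vertex-injective : ∀ {m n} → spine-vertex m ≡ spine-vertex n → m ≡ n
  spine-vertex-injective {zero}  {zero}  _  = refl
  -- Three steps to the parent undo one period of the spine.
  spine-vertex-injective {suc m} {suc n} eq = cong suc (spine-vertex-injective
    (cong (parent ∘ parent ∘ parent) eq))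

caterpillar-infinite : ∀ k → Infinite (tree k)
caterpillar-infinite k = injection⇒infinite {tree k} spine-vertex (spine-vertex-injective {k})

caterpillar : ∀ {D} → ExcludedMiddle 0ℓ → 3 ≤ D → ℕ → 𝔊 D
caterpillar em 3≤D k = record
  { graph      = tree k
  ; connected  = Caterpillar.connected k
  ; maxDegree≤ = neighbourLists⇒maxDegree≤ em (neighbourLists k)
      (λ v → ℕ.≤-trans (length-adj v) 3≤D)
  }

-- Counting the isolated points

module _ (em : ExcludedMiddle (lsuc 0ℓ)) {D : ℕ}
         (X : Setoid (lsuc 0ℓ) 0ℓ) (⌊_⌋ : Setoid.Carrier X → 𝔊 D) where
  open Setoid X using (Carrier; _≈_) renaming (sym to ≈-sym)

  private
    ballsCode : ℕ → Carrier → ℕ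
    ballsCode r x = pair r (Fin.toℕ
      (Exploration.familyCode (lower-em em) (𝔊.graph ⌊ x ⌋) (𝔊.maxDegree≤ ⌊ x ⌋) r))

    -- Equal codes have equal radii, so both sets of balls are taken at the radius that determines
    -- `x`, and they coincide.
    ballsCode-injective : ∀ {r s x y} → Determined em X ⌊_⌋ r x →
                          ballsCode r x ≡ ballsCode s y → x ≈ y
    ballsCode-injective {r} {s} {x} {y} determined eq with pair-injective r _ {s} eq
    ... | refl , codes≡ = ≈-sym (determined y
      (familyCode-injective (lower-em em) (𝔊.maxDegree≤ ⌊ x ⌋) (𝔊.maxDegree≤ ⌊ y ⌋)
        (Fin.toℕ-injective codes≡)))

  -- The radius in a code comes from the proof of `P`, so one point may have several codes, which
  -- `countablyInfinite` allows.
  determined⇒countablyInfinite : {P : Pred Carrier (lsuc 0ℓ)} →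
    (∀ {x} → P x → ∃[ r ] Determined em X ⌊_⌋ r x) →
    (f : ℕ → Σ Carrier P) → (∀ {m n} → proj₁ (f m) ≈ proj₁ (f n) → m ≡ n) →
    CountablyInfinitelyMany X P
  determined⇒countablyInfinite determined = countablyInfinite em _
    (λ (x , p) → ballsCode (proj₁ (determined p)) x)
    (λ {(_ , p)} {(_ , q)} →
      ballsCode-injective {s = proj₁ (determined q)} (proj₂ (determined p)))

theorem4p15 : (em : ExcludedMiddle (lsuc 0ℓ)) (D : ℕ) → 3 ≤ D →
    CountablyInfinitelyMany (𝔊-setoid D)
    (λ G → Infinite (𝔊.graph G) × StronglyIsolated (𝔊-setoid D) (dist em) G)
    × ((G : 𝔊∞ D) → StronglyIsolated (𝔊-setoid D) (dist em) (proj₁ G) →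
    StronglyIsolated (𝔊∞-setoid D) (dist∞ em) G)
    × CountablyInfinitelyMany (𝔊∞-setoid D) (StronglyIsolated (𝔊∞-setoid D) (dist∞ em))
theorem4p15 em D 3≤D =
  determined⇒countablyInfinite em (𝔊-setoid D) id
    (λ {G} (_ , isolated) → isolated⇒determined em (𝔊-setoid D) id {G} isolated)
    (λ k → cat k , caterpillar-infinite k , cat-isolated k)
    (λ {m n} → caterpillar-injective {m} {n}) ,
  isolated∞ ,
  -- A priori more graphs are isolated among the infinite ones, so codes are assigned afresh there.
  determined⇒countablyInfinite em (𝔊∞-setoid D) proj₁
    (λ {G} → isolated⇒determined em (𝔊∞-setoid D) proj₁ {G})
    (λ k → cat∞ k , isolated∞ (cat∞ k) (cat-isolated k))
    (λ {m n} → caterpillar-injective {m} {n})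
  where
  cat : ℕ → 𝔊 D
  cat = caterpillar (lower-em em) 3≤D

  cat∞ : ℕ → 𝔊∞ D
  cat∞ k = cat k , caterpillar-infinite k

  cat-isolated : ∀ k → StronglyIsolated (𝔊-setoid D) (dist em) (cat k)
  -- The radius is 5 + k for detecting labels, plus one for seeing the neighbours.
  cat-isolated k = determined⇒isolated em (𝔊-setoid D) id {6 + k} {cat k}
    λ H agree → ≅-sym (caterpillar-rigid k (𝔊.connected H) agree)

  isolated∞ : (H : 𝔊∞ D) → StronglyIsolated (𝔊-setoid D) (dist em) (proj₁ H) →
              StronglyIsolated (𝔊∞-setoid D) (dist∞ em) H
  isolated∞ _ (ε , 0<ε , isolated) =
    ε , 0<ε , λ ((H′ , _) , H′≇H , d≤ε) → isolated (H′ , H′≇H , d≤ε)
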